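{- Let $\phi_1,\dots,\phi_n,\psi$ be dGL formulas and let $\sigma$ be a uniform substitution that is admissible for $\phi_1,\dots,\phi_n$ and $\psi$ and satisfies $FV(\sigma)=\emptyset$. If the inference with premises $\phi_1,\dots,\phi_n$ and conclusion $\psi$ is locally sound, then the inference with premises $\sigma(\phi_1),\dots,\sigma(\phi_n)$ and conclusion $\sigma(\psi)$ is locally sound.
   Context: **Local soundness.** An inference with premises $\phi_1,\dots,\phi_n$ and conclusion $\psi$ is locally sound iff, for every interpretation $I$: if all of $\phi_1,\dots,\phi_n$ are valid in $I$, then $\psi$ is valid in $I$. **Syntax of differential game logic (dGL).** $\mathcal V$ is a countable set of variables; each $x\in\mathcal V$ has an associated differential variable $x'\in\mathcal V$ (an independent variable). Complements $U^{c}$ of $U\subseteq\mathcal V$ are in $\mathcal V$. With variables $x$, function symbols $f$ and predicate symbols $p$ (each with an arity $k\ge 0$), and game symbols $a$, the grammar is: terms $\theta,\eta ::= x \mid f(\theta_1,\dots,\theta_k)\mid \theta+\eta\mid\theta\cdot\eta\mid(\theta)'$; hybrid games $\alpha,\beta ::= a\mid x:=\theta\mid x'=\theta\,\&\,\psi\mid\, ?\psi\mid\alpha\cup\beta\mid\alpha;\beta\mid\alpha^*\mid\alpha^d$; formulas $\phi,\psi ::= \theta\ge\eta\mid p(\theta_1,\dots,\theta_k)\mid\neg\phi\mid\phi\wedge\psi\mid\exists x\,\phi\mid\langle\alpha\rangle\phi$. $\Sigma(e)$ is the set of function, predicate and game symbols occurring in the expression $e$. **Semantics.** A state is a map $\omega:\mathcal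 V\to\mathbb R$; $\mathcal S$ is the set of states; $\omega_x^r$ is $\omega$ with the value of $x$ changed to $r$. An interpretation $I$ maps each $k$-ary $f$ to a smooth function $I(f):\mathbb R^k\to\mathbb R$, each $k$-ary $p$ to $I(p)\subseteq\mathbb R^k$, and each game symbol $a$ to a monotone function $I(a):2^{\mathcal S}\to2^{\mathcal S}$ (if $X\subseteq Y$ then $I(a)(X)\subseteq I(a)(Y)$). The value $I\omega[\![\theta]\!]\in\mathbb R$ of a term is defined as usual, with $I\omega[\![(\theta)']\!]=\sum_{x\in\mathcal V}\omega(x')\,\frac{\partial I[\![\theta]\!]}{\partial x}(\omega)$. Formulas denote sets $I[\![\phi]\!]\subseteq\mathcal S$ and games denote functions $I[\![\alpha]\!]:2^{\mathcal S}\to2^{\mathcal S}$, by simultaneous induction: $I[\![\theta\ge\eta]\!]=\{\omega: I\omega[\![\theta]\!]\ge I\omega[\![\eta]\!]\}$; $I[\![p(\theta_1,\dots,\theta_k)]\!]=\{\omega:(I\omega[\![\theta_1]\!],\dots,I\omega[\![\theta_k]\!])\in I(p)\}$; $I[\![\neg\phi]\!]=\mathcal S\setminus I[\![\phi]\!]$; $I[\![\phi\wedge\psi]\!]=I[\![\phi]\!]\cap I[\![\psi]\!]$; $I[\![\exists x\,\phi]\!]=\{\omega:\omega_x^r\in I[\![\phi]\!]\text{ for some }r\in\mathbb R\}$; $I[\![\langle\alpha\rangle\phi]\!]=I[\![\alpha]\!](I[\![\phi]\!])$; $I[\![a]\!](X)=I(a)(X)$; $I[\![x:=\theta]\!](X)=\{\omega:\omega_x^{I\omega[\![\theta]\!]}\in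 X\}$; $I[\![?\psi]\!](X)=I[\![\psi]\!]\cap X$; $I[\![\alpha\cup\beta]\!](X)=I[\![\alpha]\!](X)\cup I[\![\beta]\!](X)$; $I[\![\alpha;\beta]\!](X)=I[\![\alpha]\!](I[\![\beta]\!](X))$; $I[\![\alpha^*]\!](X)=\bigcap\{Z\subseteq\mathcal S: X\cup I[\![\alpha]\!](Z)\subseteq Z\}$; $I[\![\alpha^d]\!](X)=\mathcal S\setminus I[\![\alpha]\!](\mathcal S\setminus X)$; $I[\![x'=\theta\,\&\,\psi]\!](X)$ is the set of $\omega$ for which there are $r\ge0$ and $\varphi:[0,r]\to\mathcal S$ with $\varphi(0)=\omega$ on $\{x'\}^c$, $\varphi(r)\in X$, and for all $0\le\zeta\le r$: $\varphi(\zeta)(x')=I\varphi(\zeta)[\![\theta]\!]$, $\varphi(\zeta)\in I[\![\psi]\!]$, $\varphi(\zeta)=\varphi(0)$ on $\{x,x'\}^c$, and, if $r>0$, the derivative of $t\mapsto\varphi(t)(x)$ at $\zeta$ exists and equals $\varphi(\zeta)(x')$. $\phi$ is valid in $I$ iff $I[\![\phi]\!]=\mathcal S$. **Static semantics.** For $X\subseteq\mathcal S$, $V\subseteq\mathcal V$, $\omega\in\mathcal S$ let $X{\downarrow}\omega(V)=\{\nu\in X:\nu=\omega\text{ on }V\}$. Free variables of a term $\theta$: $x\in FV(\theta)$ iff there are $I$ and $\omega,\tilde\omega$ with $\omega=\tilde\omega$ on $\{x\}^c$ and $I\omega[\![\theta]\!]\ne I\tilde\omega[\![\theta]\!]$.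 Of a formula $\phi$: $x\in FV(\phi)$ iff there are $I$ and $\omega=\tilde\omega$ on $\{x\}^c$ with $\omega\in I[\![\phi]\!]\not\ni\tilde\omega$. Bound variables of a game: $x\in BV(\alpha)$ iff there are $I,\omega,X$ with $\omega\in I[\![\alpha]\!](X)$ but $\omega\notin I[\![\alpha]\!](X{\downarrow}\omega(\{x\}))$. **Uniform substitutions.** A uniform substitution $\sigma$ replaces some symbols: it maps function symbols (written $f(\cdot)$) to terms $\sigma f(\cdot)$, predicate symbols $p(\cdot)$ to formulas $\sigma p(\cdot)$, and game symbols $a$ to hybrid games $\sigma a$ (symbols not replaced stay unchanged). Here $\cdot$ is a reserved function symbol of arity 0 marking the position of the argument (for arity $k$, analogously a vector of $k$ such symbols). $FV(\sigma)=\bigcup_f FV(\sigma f(\cdot))\cup\bigcup_p FV(\sigma p(\cdot))$ over the function and predicate symbols replaced by $\sigma$. For $U\subseteq\mathcal V$, $\sigma$ is $U$-admissible for an expression $e$ iff $FV(\sigma|_{\Sigma(e)})\cap U=\emptyset$, where $\sigma|_{\Sigma(e)}$ only replaces symbols occurring in $e$. The application $\sigma(e)$ is defined recursively: $\sigma(x)=x$; $\sigma(f(\theta))=\{\cdot\mapsto\sigma(\theta)\}(\sigma f(\cdot))$; $\sigma(\theta+\eta)=\sigma(\theta)+\sigma(\eta)$; $\sigma(\theta\cdot\eta)=\sigma(\theta)\cdot\sigma(\eta)$; $\sigma((\theta)')=(\sigma(\theta))'$ if $\sigma$ is $\mathcal V$-admissible for $\theta$; $\sigma(\theta\ge\eta)=\sigma(\theta)\ge\sigma(\eta)$;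 $\sigma(p(\theta))=\{\cdot\mapsto\sigma(\theta)\}(\sigma p(\cdot))$; $\sigma(\neg\phi)=\neg\sigma(\phi)$; $\sigma(\phi\wedge\psi)=\sigma(\phi)\wedge\sigma(\psi)$; $\sigma(\exists x\,\phi)=\exists x\,\sigma(\phi)$ if $\sigma$ is $\{x\}$-admissible for $\phi$; $\sigma(\langle\alpha\rangle\phi)=\langle\sigma(\alpha)\rangle\sigma(\phi)$ if $\sigma$ is $BV(\sigma(\alpha))$-admissible for $\phi$; $\sigma(a)=\sigma a$; $\sigma(x:=\theta)=(x:=\sigma(\theta))$; $\sigma(x'=\theta\,\&\,\psi)=(x'=\sigma(\theta)\,\&\,\sigma(\psi))$ if $\sigma$ is $\{x,x'\}$-admissible for $\theta$ and $\psi$; $\sigma(?\psi)=\,?\sigma(\psi)$; $\sigma(\alpha\cup\beta)=\sigma(\alpha)\cup\sigma(\beta)$; $\sigma(\alpha;\beta)=\sigma(\alpha);\sigma(\beta)$ if $\sigma$ is $BV(\sigma(\alpha))$-admissible for $\beta$; $\sigma(\alpha^*)=(\sigma(\alpha))^*$ if $\sigma$ is $BV(\sigma(\alpha))$-admissible for $\alpha$; $\sigma(\alpha^d)=(\sigma(\alpha))^d$. $\sigma$ is admissible for $e$ iff all side conditions arising in the recursive computation of $\sigma(e)$ (including those of the auxiliary substitutions $\{\cdot\mapsto\sigma(\theta)\}$) are satisfied, so that $\sigma(e)$ is defined. -}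

module Defs where

open import Algebra.Structures using (IsCommutativeRing)
open import Axiom.ExcludedMiddle using (ExcludedMiddle)
open import Data.Bool using (Bool; T; not; _∧_; _∨_)
open import Data.Fin using (Fin)
open import Data.List as List using (List)
open import Data.List.Membership.Propositional using () renaming (_∉_ to _∉ˡ_)
open import Data.List.Relation.Unary.Unique.Propositional using (Unique)
open import Data.Maybe using (Maybe; just; nothing)
open import Data.Nat as ℕ using (ℕ; zero; suc)
open import Data.Product using (Σ-syntax; ∃; ∃-syntax; _×_; _,_; proj₁)
open import Data.Sum using ([_,_]′)
open import Data.Unit using (⊤)
open import Data.Vec as Vec using (Vec; []; _∷_)
open import Function using (Injective; _↣_; const)
open import Level using (0ℓ)
open import Relation.Binary.Definitions using (DecidableEquality)
open import Relation.Binary.PropositionalEquality using (_≡_; _≢_)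
open import Relation.Binary.Structures using (IsTotalOrder)
open import Relation.Nullary using (¬_; yes; no; does)
open import Relation.Nullary.Decidable using (via-injection)
open import Relation.Unary
  using (Pred; _∈_; _∉_; _∪_; _∩_; ｛_｝; ∁; ∅; U; Empty; Satisfiable)

-- A Dedekind-complete ordered field.  Such fields are unique up to unique
-- isomorphism, so quantifying over them amounts to fixing the reals.
record Reals : Set₁ where
  infix  4 _≤_
  infixl 6 _+_
  infixl 7 _*_
  infix  8 -_
  field
    ℝ     : Set
    _+_   : ℝ → ℝ → ℝ
    _*_   : ℝ → ℝ → ℝ
    -_    : ℝ → ℝ
    0#    : ℝ
    1#    : ℝ
    _≤_   : ℝ → ℝ → Set

    isCommutativeRing : IsCommutativeRing _≡_ _+_ _*_ -_ 0# 1#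
    0≢1               : 0# ≢ 1#
    inverse           : ∀ x → x ≢ 0# → ∃[ y ] x * y ≡ 1#
    isTotalOrder      : IsTotalOrder _≡_ _≤_
    +-monoˡ-≤         : ∀ z {x y} → x ≤ y → x + z ≤ y + z
    *-nonNegative     : ∀ {x y} → 0# ≤ x → 0# ≤ y → 0# ≤ x * y

  UpperBound : Pred ℝ 0ℓ → Pred ℝ 0ℓ
  UpperBound A u = ∀ {x} → x ∈ A → x ≤ u

  field
    supremum : (A : Pred ℝ 0ℓ) → Satisfiable A → Satisfiable (UpperBound A) →
               ∃[ s ] UpperBound A s × (∀ u → UpperBound A u → s ≤ u)

-- Function and predicate symbols are indexed by their arity.
record Language : Set₁ where
  field
    𝒱           : Set
    countable   : 𝒱 ↣ ℕ
    _′          : 𝒱 → 𝒱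
    ′-injective : Injective _≡_ _≡_ _′
    x′≢x        : ∀ x → x ′ ≢ x
    FunName     : ℕ → Set
    PredSym     : ℕ → Set
    GameSym     : Set

  _≟ᵛ_ : DecidableEquality 𝒱
  _≟ᵛ_ = via-injection countable ℕ._≟_

module Analysis (ℛ : Reals) where

  open Reals ℛ public
  open IsTotalOrder isTotalOrder using (total)

  infix  4 _<_
  infixl 6 _-_

  _<_ : ℝ → ℝ → Set
  x < y = x ≤ y × x ≢ y

  _-_ : ℝ → ℝ → ℝ
  x - y = x + (- y)

  ∣_∣ : ℝ → ℝ
  ∣ x ∣ = [ const x , const (- x) ]′ (total 0# x)

  -- Derivatives are stated without division; restricting s to D yields
  -- one-sided derivatives at the end points of an interval D.
  HasDerivativeWithin : Pred ℝ 0ℓ → (ℝ → ℝ) → ℝ → ℝ → Set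
  HasDerivativeWithin D g t l =
    ∀ ε → 0# < ε → ∃[ δ ] 0# < δ ×
      (∀ s → s ∈ D → ∣ s - t ∣ < δ →
        ∣ (g s - g t) - l * (s - t) ∣ ≤ ε * ∣ s - t ∣)

  HasDerivative : (ℝ → ℝ) → ℝ → ℝ → Set
  HasDerivative = HasDerivativeWithin U

  ∑ : ∀ {k} → Vec ℝ k → ℝ
  ∑ = Vec.foldr′ _+_ 0#

  ∥_∥ : ∀ {k} → Vec ℝ k → ℝ
  ∥ v ∥ = ∑ (Vec.map ∣_∣ v)

  -- Total (Fréchet) differentiability; the choice of norm is immaterial.
  HasGradient : ∀ {k} → (Vec ℝ k → ℝ) → Vec ℝ k → Vec ℝ k → Set
  HasGradient f a g =
    ∀ ε → 0# < ε → ∃[ δ ] 0# < δ ×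
      (∀ v → let h = Vec.zipWith _-_ v a in ∥ h ∥ < δ →
        ∣ (f v - f a) - ∑ (Vec.zipWith _*_ g h) ∣ ≤ ε * ∥ h ∥)

  Differentiable : ∀ {k} → ℕ → (Vec ℝ k → ℝ) → Set
  Differentiable     zero    f = ⊤
  Differentiable {k} (suc n) f =
    Σ[ ∂f ∈ (Fin k → Vec ℝ k → ℝ) ]
      (∀ a → HasGradient f a (Vec.tabulate λ i → ∂f i a)) ×
      (∀ i → Differentiable n (∂f i))

  Smooth : ∀ {k} → (Vec ℝ k → ℝ) → Set
  Smooth f = ∀ n → Differentiable n f

-- Under excluded middle, Bool-valued maps are the classical powerset.  Using
-- them keeps 2^𝒮, and hence interpretations and fixpoints, in Set.
module Powerset (em : ExcludedMiddle 0ℓ) where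

  𝒫 : Set → Set
  𝒫 A = A → Bool

  module _ {A : Set} where

    infix  4 _∈ᵖ_ _∉ᵖ_ _⊆ᵖ_
    infixr 7 _∩ᵖ_
    infixr 6 _∪ᵖ_

    _∈ᵖ_ _∉ᵖ_ : A → 𝒫 A → Set
    a ∈ᵖ X = T (X a)
    a ∉ᵖ X = ¬ (a ∈ᵖ X)

    _⊆ᵖ_ : 𝒫 A → 𝒫 A → Set
    X ⊆ᵖ Y = ∀ {a} → a ∈ᵖ X → a ∈ᵖ Y

    -- { a ∣ P a }
    ⟪_⟫ : Pred A 0ℓ → 𝒫 A
    ⟪ P ⟫ a = does (em {P a})

    _∩ᵖ_ _∪ᵖ_ : 𝒫 A → 𝒫 A → 𝒫 A
    (X ∩ᵖ Y) a = X a ∧ Y a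
    (X ∪ᵖ Y) a = X a ∨ Y a

    ∁ᵖ : 𝒫 A → 𝒫 A
    ∁ᵖ X a = not (X a)

module dGL (ℛ : Reals) (em : ExcludedMiddle 0ℓ) (ℒ : Language) where

  open Analysis ℛ public
  open Powerset em public
  open Language ℒ public

  -- dot 0, …, dot (k - 1) are the reserved nullary symbols that mark the
  -- argument positions in the replacement of a k-ary symbol.  Semantically
  -- they are function symbols like any other.
  data FunSym : ℕ → Set where
    fun : ∀ {k} → FunName k → FunSym k
    dot : ℕ → FunSym 0

  infix  5 _⩾_ _≔_ _′=_&_
  infixl 6 _⊕_
  infixl 7 _⊙_
  infixr 4 _⩓_
  infixr 3 _⨟_
  infixr 2 _⊔_

  data Term : Set where
    var : 𝒱 → Term
    app : ∀ {k} → FunSym k → Vec Term k → Term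
    _⊕_ : Term → Term → Term
    _⊙_ : Term → Term → Term
    D   : Term → Term

  data Formula : Set
  data Game : Set

  data Formula where
    _⩾_  : Term → Term → Formula
    pred : ∀ {k} → PredSym k → Vec Term k → Formula
    neg  : Formula → Formula
    _⩓_  : Formula → Formula → Formula
    ex   : 𝒱 → Formula → Formula
    ⟨_⟩_ : Game → Formula → Formula

  data Game where
    game   : GameSym → Game
    _≔_    : 𝒱 → Term → Game
    _′=_&_ : 𝒱 → Term → Formula → Game
    test   : Formula → Game
    _⊔_    : Game → Game → Game
    _⨟_    : Game → Game → Game
    _*ᵍ    : Game → Game
    _ᵈ     : Game → Game

  data Symbol : Set where
    funˢ  : ∀ {k} → FunSym k → Symbol
    predˢ : ∀ {k} → PredSym k → Symbol
    gameˢ : GameSym → Symbol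

  Σᵗ  : Term → Pred Symbol 0ℓ
  Σᵗˢ : ∀ {k} → Vec Term k → Pred Symbol 0ℓ

  Σᵗ (var x)    = ∅
  Σᵗ (app f θs) = ｛ funˢ f ｝ ∪ Σᵗˢ θs
  Σᵗ (θ ⊕ η)    = Σᵗ θ ∪ Σᵗ η
  Σᵗ (θ ⊙ η)    = Σᵗ θ ∪ Σᵗ η
  Σᵗ (D θ)      = Σᵗ θ

  Σᵗˢ []       = ∅
  Σᵗˢ (θ ∷ θs) = Σᵗ θ ∪ Σᵗˢ θs

  Σᶠ : Formula → Pred Symbol 0ℓ
  Σᵍ : Game → Pred Symbol 0ℓ

  Σᶠ (θ ⩾ η)     = Σᵗ θ ∪ Σᵗ η
  Σᶠ (pred p θs) = ｛ predˢ p ｝ ∪ Σᵗˢ θs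
  Σᶠ (neg φ)     = Σᶠ φ
  Σᶠ (φ ⩓ ψ)     = Σᶠ φ ∪ Σᶠ ψ
  Σᶠ (ex x φ)    = Σᶠ φ
  Σᶠ (⟨ α ⟩ φ)   = Σᵍ α ∪ Σᶠ φ

  Σᵍ (game a)     = ｛ gameˢ a ｝
  Σᵍ (x ≔ θ)      = Σᵗ θ
  Σᵍ (x ′= θ & ψ) = Σᵗ θ ∪ Σᶠ ψ
  Σᵍ (test ψ)     = Σᶠ ψ
  Σᵍ (α ⊔ β)      = Σᵍ α ∪ Σᵍ β
  Σᵍ (α ⨟ β)      = Σᵍ α ∪ Σᵍ β
  Σᵍ (α *ᵍ)       = Σᵍ α
  Σᵍ (α ᵈ)        = Σᵍ α

  State : Set
  State = 𝒱 → ℝ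

  _[_↦_] : State → 𝒱 → ℝ → State
  (ω [ x ↦ r ]) y with y ≟ᵛ x
  ... | yes _ = r
  ... | no  _ = ω y

  Agree : Pred 𝒱 0ℓ → State → State → Set
  Agree V ω ν = ∀ x → x ∈ V → ω x ≡ ν x

  record Interpretation : Set where
    field
      funᴵ   : ∀ {k} → FunSym k → Vec ℝ k → ℝ
      smooth : ∀ {k} (f : FunSym k) → Smooth (funᴵ f)
      predᴵ  : ∀ {k} → PredSym k → 𝒫 (Vec ℝ k)
      gameᴵ  : GameSym → 𝒫 State → 𝒫 State
      mono   : ∀ a {X Y} → X ⊆ᵖ Y → gameᴵ a X ⊆ᵖ gameᴵ a Y

  open Interpretation public

  -- ∂F/∂x (ω), with the junk value 0 where it does not exist.
  ∂ : (State → ℝ) → 𝒱 → State → ℝ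
  ∂ F x ω with em {∃[ l ] HasDerivative (λ r → F (ω [ x ↦ r ])) (ω x) l}
  ... | yes (l , _) = l
  ... | no  _       = 0#

  -- The sum of a finitely supported family, with the junk value 0 for families
  -- of infinite support.  The value does not depend on the chosen list.
  ∑𝒱 : (𝒱 → ℝ) → ℝ
  ∑𝒱 h with em {∃[ xs ] Unique xs × (∀ x → x ∉ˡ xs → h x ≡ 0#)}
  ... | yes (xs , _) = List.foldr _+_ 0# (List.map h xs)
  ... | no  _        = 0#

  ⟦_⟧ᵗ  : Term → Interpretation → State → ℝ
  ⟦_⟧ᵗˢ : ∀ {k} → Vec Term k → Interpretation → State → Vec ℝ k

  ⟦ var x ⟧ᵗ    I ω = ω x
  ⟦ app f θs ⟧ᵗ I ω = funᴵ I f (⟦ θs ⟧ᵗˢ I ω)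
  ⟦ θ ⊕ η ⟧ᵗ    I ω = ⟦ θ ⟧ᵗ I ω + ⟦ η ⟧ᵗ I ω
  ⟦ θ ⊙ η ⟧ᵗ    I ω = ⟦ θ ⟧ᵗ I ω * ⟦ η ⟧ᵗ I ω
  ⟦ D θ ⟧ᵗ      I ω = ∑𝒱 λ x → ω (x ′) * ∂ (⟦ θ ⟧ᵗ I) x ω

  ⟦ [] ⟧ᵗˢ     I ω = []
  ⟦ θ ∷ θs ⟧ᵗˢ I ω = ⟦ θ ⟧ᵗ I ω ∷ ⟦ θs ⟧ᵗˢ I ω

  -- A play of x′ = F & Q from ω into X.  The flow is given on all of ℝ, but
  -- only its restriction to [0, r] is constrained.
  record Evolution (x : 𝒱) (F : State → ℝ) (Q X : 𝒫 State) (ω : State) : Set where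
    field
      r : ℝ
      φ : ℝ → State

    Duration : Pred ℝ 0ℓ
    Duration ζ = 0# ≤ ζ × ζ ≤ r

    field
      r≥0    : 0# ≤ r
      start  : Agree (∁ ｛ x ′ ｝) (φ 0#) ω
      end    : φ r ∈ᵖ X
      slope  : ∀ ζ → ζ ∈ Duration → φ ζ (x ′) ≡ F (φ ζ)
      domain : ∀ ζ → ζ ∈ Duration → φ ζ ∈ᵖ Q
      frame  : ∀ ζ → ζ ∈ Duration → Agree (∁ (｛ x ｝ ∪ ｛ x ′ ｝)) (φ ζ) (φ 0#)
      solves : ∀ ζ → ζ ∈ Duration → 0# < r →
               HasDerivativeWithin Duration (λ t → φ t x) ζ (φ ζ (x ′))

  ⟦_⟧ᶠ : Formula → Interpretation → 𝒫 State
  ⟦_⟧ᵍ : Game → Interpretation → 𝒫 State → 𝒫 State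

  ⟦ θ ⩾ η ⟧ᶠ     I = ⟪ (λ ω → ⟦ η ⟧ᵗ I ω ≤ ⟦ θ ⟧ᵗ I ω) ⟫
  ⟦ pred p θs ⟧ᶠ I = λ ω → predᴵ I p (⟦ θs ⟧ᵗˢ I ω)
  ⟦ neg φ ⟧ᶠ     I = ∁ᵖ (⟦ φ ⟧ᶠ I)
  ⟦ φ ⩓ ψ ⟧ᶠ     I = ⟦ φ ⟧ᶠ I ∩ᵖ ⟦ ψ ⟧ᶠ I
  ⟦ ex x φ ⟧ᶠ    I = ⟪ (λ ω → ∃[ r ] ω [ x ↦ r ] ∈ᵖ ⟦ φ ⟧ᶠ I) ⟫
  ⟦ ⟨ α ⟩ φ ⟧ᶠ   I = ⟦ α ⟧ᵍ I (⟦ φ ⟧ᶠ I)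

  ⟦ game a ⟧ᵍ     I X = gameᴵ I a X
  ⟦ x ≔ θ ⟧ᵍ      I X = λ ω → X (ω [ x ↦ ⟦ θ ⟧ᵗ I ω ])
  ⟦ x ′= θ & ψ ⟧ᵍ I X = ⟪ Evolution x (⟦ θ ⟧ᵗ I) (⟦ ψ ⟧ᶠ I) X ⟫
  ⟦ test ψ ⟧ᵍ     I X = ⟦ ψ ⟧ᶠ I ∩ᵖ X
  ⟦ α ⊔ β ⟧ᵍ      I X = ⟦ α ⟧ᵍ I X ∪ᵖ ⟦ β ⟧ᵍ I X
  ⟦ α ⨟ β ⟧ᵍ      I X = ⟦ α ⟧ᵍ I (⟦ β ⟧ᵍ I X)
  ⟦ α *ᵍ ⟧ᵍ       I X = ⟪ (λ ω → ∀ Z → (X ∪ᵖ ⟦ α ⟧ᵍ I Z) ⊆ᵖ Z → ω ∈ᵖ Z) ⟫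
  ⟦ α ᵈ ⟧ᵍ        I X = ∁ᵖ (⟦ α ⟧ᵍ I (∁ᵖ X))

  ValidIn : Interpretation → Formula → Set
  ValidIn I φ = ∀ ω → ω ∈ᵖ ⟦ φ ⟧ᶠ I

  LocallySound : ∀ {n} → (Fin n → Formula) → Formula → Set
  LocallySound φ ψ = ∀ I → (∀ i → ValidIn I (φ i)) → ValidIn I ψ

  _↓_⟨_⟩ : 𝒫 State → State → Pred 𝒱 0ℓ → 𝒫 State
  X ↓ ω ⟨ V ⟩ = ⟪ (λ ν → ν ∈ᵖ X × Agree V ν ω) ⟫

  FVᵗ : Term → Pred 𝒱 0ℓ
  FVᵗ θ x = ∃[ I ] ∃[ ω ] ∃[ ν ] Agree (∁ ｛ x ｝) ω ν × ⟦ θ ⟧ᵗ I ω ≢ ⟦ θ ⟧ᵗ I ν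

  FVᶠ : Formula → Pred 𝒱 0ℓ
  FVᶠ φ x = ∃[ I ] ∃[ ω ] ∃[ ν ]
    Agree (∁ ｛ x ｝) ω ν × ω ∈ᵖ ⟦ φ ⟧ᶠ I × ν ∉ᵖ ⟦ φ ⟧ᶠ I

  BV : Game → Pred 𝒱 0ℓ
  BV α x = ∃[ I ] ∃[ ω ] ∃[ X ]
    ω ∈ᵖ ⟦ α ⟧ᵍ I X × ω ∉ᵖ ⟦ α ⟧ᵍ I (X ↓ ω ⟨ ｛ x ｝ ⟩)

  -- nothing: the symbol is not replaced.
  record Subst : Set where
    field
      fun⁺  : ∀ {k} → FunSym k → Maybe Term
      pred⁺ : ∀ {k} → PredSym k → Maybe Formula
      game⁺ : GameSym → Maybe Game

  open Subst public

  FVˢ : Subst → Pred 𝒱 0ℓ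
  FVˢ σ =
    (λ x → ∃[ k ] Σ[ f ∈ FunSym k ] ∃[ θ ] fun⁺ σ f ≡ just θ × x ∈ FVᵗ θ) ∪
    (λ x → ∃[ k ] Σ[ p ∈ PredSym k ] ∃[ φ ] pred⁺ σ p ≡ just φ × x ∈ FVᶠ φ)

  _↾_ : Subst → Pred Symbol 0ℓ → Subst
  σ ↾ S = record
    { fun⁺  = λ f → keep (funˢ f) (fun⁺ σ f)
    ; pred⁺ = λ p → keep (predˢ p) (pred⁺ σ p)
    ; game⁺ = λ a → keep (gameˢ a) (game⁺ σ a)
    }
    where
    keep : ∀ {A : Set} → Symbol → Maybe A → Maybe A
    keep s m with em {s ∈ S}
    ... | yes _ = m
    ... | no  _ = nothing

  -- σ is V-admissible for an expression whose set of symbols is S.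
  _isAdmissible[_]For_ : Subst → Pred 𝒱 0ℓ → Pred Symbol 0ℓ → Set
  σ isAdmissible[ V ]For S = Empty (FVˢ (σ ↾ S) ∩ V)

  _!?_ : ∀ {A : Set} {k} → Vec A k → ℕ → Maybe A
  []       !? _     = nothing
  (a ∷ _)  !? zero  = just a
  (_ ∷ as) !? suc i = as !? i

  -- {· ↦ θs}
  dots↦ : ∀ {k} → Vec Term k → Subst
  dots↦ θs = record
    { fun⁺  = λ { (fun _) → nothing ; (dot i) → θs !? i }
    ; pred⁺ = λ _ → nothing
    ; game⁺ = λ _ → nothing
    }

  -- Application of σ is a partial operation, given by its graph: σ ⊢ e ↦ e′
  -- states that σ(e) is defined and equal to e′.  A function is not available
  -- by structural recursion, since {· ↦ σ(θs)} is applied to σf(·).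
  infix 1 _⊢_↦ᵗ_ _⊢_↦ᵗˢ_ _⊢_↦ᶠ_ _⊢_↦ᵍ_

  data _⊢_↦ᵗ_  (σ : Subst) : Term → Term → Set
  data _⊢_↦ᵗˢ_ (σ : Subst) : ∀ {k} → Vec Term k → Vec Term k → Set

  data _⊢_↦ᵗ_ σ where
    var  : ∀ {x} → σ ⊢ var x ↦ᵗ var x
    keep : ∀ {k} {f : FunSym k} {θs θs′} →
           fun⁺ σ f ≡ nothing →
           σ ⊢ θs ↦ᵗˢ θs′ →
           σ ⊢ app f θs ↦ᵗ app f θs′
    repl : ∀ {k} {f : FunSym k} {θs θs′ σf η} →
           fun⁺ σ f ≡ just σf →
           σ ⊢ θs ↦ᵗˢ θs′ →
           dots↦ θs′ ⊢ σf ↦ᵗ η →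
           σ ⊢ app f θs ↦ᵗ η
    _⊕_  : ∀ {θ θ′ η η′} →
           σ ⊢ θ ↦ᵗ θ′ → σ ⊢ η ↦ᵗ η′ → σ ⊢ θ ⊕ η ↦ᵗ θ′ ⊕ η′
    _⊙_  : ∀ {θ θ′ η η′} →
           σ ⊢ θ ↦ᵗ θ′ → σ ⊢ η ↦ᵗ η′ → σ ⊢ θ ⊙ η ↦ᵗ θ′ ⊙ η′
    D    : ∀ {θ θ′} →
           σ isAdmissible[ U ]For Σᵗ θ →
           σ ⊢ θ ↦ᵗ θ′ → σ ⊢ D θ ↦ᵗ D θ′

  data _⊢_↦ᵗˢ_ σ where
    []  : σ ⊢ [] ↦ᵗˢ []
    _∷_ : ∀ {k θ θ′} {θs θs′ : Vec Term k} →
          σ ⊢ θ ↦ᵗ θ′ → σ ⊢ θs ↦ᵗˢ θs′ → σ ⊢ θ ∷ θs ↦ᵗˢ θ′ ∷ θs′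

  data _⊢_↦ᶠ_ (σ : Subst) : Formula → Formula → Set
  data _⊢_↦ᵍ_ (σ : Subst) : Game → Game → Set

  data _⊢_↦ᶠ_ σ where
    _⩾_  : ∀ {θ θ′ η η′} →
           σ ⊢ θ ↦ᵗ θ′ → σ ⊢ η ↦ᵗ η′ → σ ⊢ θ ⩾ η ↦ᶠ θ′ ⩾ η′
    keep : ∀ {k} {p : PredSym k} {θs θs′} →
           pred⁺ σ p ≡ nothing →
           σ ⊢ θs ↦ᵗˢ θs′ →
           σ ⊢ pred p θs ↦ᶠ pred p θs′
    repl : ∀ {k} {p : PredSym k} {θs θs′ σp χ} →
           pred⁺ σ p ≡ just σp →
           σ ⊢ θs ↦ᵗˢ θs′ →
           dots↦ θs′ ⊢ σp ↦ᶠ χ →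
           σ ⊢ pred p θs ↦ᶠ χ
    neg  : ∀ {φ φ′} → σ ⊢ φ ↦ᶠ φ′ → σ ⊢ neg φ ↦ᶠ neg φ′
    _⩓_  : ∀ {φ φ′ ψ ψ′} →
           σ ⊢ φ ↦ᶠ φ′ → σ ⊢ ψ ↦ᶠ ψ′ → σ ⊢ φ ⩓ ψ ↦ᶠ φ′ ⩓ ψ′
    ex   : ∀ {x φ φ′} →
           σ isAdmissible[ ｛ x ｝ ]For Σᶠ φ →
           σ ⊢ φ ↦ᶠ φ′ → σ ⊢ ex x φ ↦ᶠ ex x φ′
    dia  : ∀ {α α′ φ φ′} →
           σ ⊢ α ↦ᵍ α′ →
           σ isAdmissible[ BV α′ ]For Σᶠ φ →
           σ ⊢ φ ↦ᶠ φ′ → σ ⊢ ⟨ α ⟩ φ ↦ᶠ ⟨ α′ ⟩ φ′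

  data _⊢_↦ᵍ_ σ where
    keep : ∀ {a} → game⁺ σ a ≡ nothing → σ ⊢ game a ↦ᵍ game a
    repl : ∀ {a α} → game⁺ σ a ≡ just α → σ ⊢ game a ↦ᵍ α
    asgn : ∀ {x θ θ′} → σ ⊢ θ ↦ᵗ θ′ → σ ⊢ x ≔ θ ↦ᵍ x ≔ θ′
    ode  : ∀ {x θ θ′ ψ ψ′} →
           σ isAdmissible[ ｛ x ｝ ∪ ｛ x ′ ｝ ]For Σᵗ θ →
           σ isAdmissible[ ｛ x ｝ ∪ ｛ x ′ ｝ ]For Σᶠ ψ →
           σ ⊢ θ ↦ᵗ θ′ → σ ⊢ ψ ↦ᶠ ψ′ →
           σ ⊢ x ′= θ & ψ ↦ᵍ x ′= θ′ & ψ′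
    test : ∀ {ψ ψ′} → σ ⊢ ψ ↦ᶠ ψ′ → σ ⊢ test ψ ↦ᵍ test ψ′
    _⊔_  : ∀ {α α′ β β′} →
           σ ⊢ α ↦ᵍ α′ → σ ⊢ β ↦ᵍ β′ → σ ⊢ α ⊔ β ↦ᵍ α′ ⊔ β′
    seq  : ∀ {α α′ β β′} →
           σ ⊢ α ↦ᵍ α′ →
           σ isAdmissible[ BV α′ ]For Σᵍ β →
           σ ⊢ β ↦ᵍ β′ → σ ⊢ α ⨟ β ↦ᵍ α′ ⨟ β′
    loop : ∀ {α α′} →
           σ ⊢ α ↦ᵍ α′ →
           σ isAdmissible[ BV α′ ]For Σᵍ α →
           σ ⊢ α *ᵍ ↦ᵍ α′ *ᵍ
    dual : ∀ {α α′} → σ ⊢ α ↦ᵍ α′ → σ ⊢ α ᵈ ↦ᵍ α′ ᵈ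

  Admissible : Subst → Formula → Set
  Admissible σ φ = ∃[ φ′ ] (σ ⊢ φ ↦ᶠ φ′)

  apply : ∀ {σ φ} → Admissible σ φ → Formula
  apply = proj₁

{-# OPTIONS --safe #-}

-- If FV(σ) = ∅, an interpretation I has an adjoint: it interprets each replaced
-- symbol by the value of its replacement under I, with the dots set to the
-- arguments, and this does not depend on the state.  Then I⟦σ(φ)⟧ is the value of
-- φ in the adjoint, so validity of σ(φᵢ) in I is validity of φᵢ in the adjoint, and
-- local soundness transfers.  Three points need work.  The adjoint must interpret
-- function symbols by smooth functions, although replacements may contain
-- differentials.  The inner substitutions {· ↦ σ(θ)} have free variables; for them
-- the same comparison holds pointwise, by admissibility.  Finally FV and BV are
-- defined by changing one variable at a time, but coincidence and bound effect are
-- needed for infinitely many variables at once.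
module Submission where

open import Algebra.Bundles using (CommutativeRing; RawRing)
open import Algebra.Solver.Ring.AlmostCommutativeRing using (fromCommutativeRing; _-Raw-AlmostCommutative⟶_)
import Algebra.Properties.AbelianGroup as AbelianGroupProperties
import Algebra.Properties.Ring as RingProperties
import Algebra.Properties.Semiring.Mult as Multiples
import Algebra.Solver.Ring as RingSolver
import Algebra.Solver.Ring.NaturalCoefficients.Default as SemiringSolver
open import Axiom.ExcludedMiddle using (ExcludedMiddle)
open import Axiom.Extensionality.Propositional using (Extensionality)
open import Data.Bool using (true; false; T; not; _∧_; _∨_)
open import Data.Bool.Properties using (T-∧; T-∨; T?)
open import Data.Empty using (⊥-elim)
open import Data.Fin using (Fin; zero; suc)
open import Data.List as List using (List; []; _∷_; _++_; deduplicate)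
open import Data.List.Membership.Propositional using () renaming (_∈_ to _∈ˡ_; _∉_ to _∉ˡ_)
import Data.List.Membership.DecPropositional as DecMembership
open import Data.List.Membership.Propositional.Properties using (∈-map⁺; ∈-++⁺ˡ; ∈-++⁺ʳ; ∈-deduplicate⁺)
open import Data.List.Relation.Unary.All as All using (All)
open import Data.List.Relation.Unary.AllPairs using ([]; _∷_)
open import Data.List.Relation.Unary.Any using (here; there)
open import Data.List.Relation.Unary.Unique.DecPropositional.Properties using (deduplicate-!)
open import Data.List.Relation.Unary.Unique.Propositional using (Unique)
open import Data.Maybe as Maybe using (Maybe; just; nothing; maybe′; fromMaybe)
open import Data.Nat as ℕ using (ℕ; zero; suc)
open import Data.Product using (∃-syntax; _×_; _,_; proj₁; proj₂)
open import Data.Sum using (_⊎_; inj₁; inj₂; [_,_]′) renaming (map to ⊎-map)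
open import Data.Unit using (tt)
open import Data.Vec as Vec using (Vec; []; _∷_; lookup; tabulate)
open import Data.Vec.Properties using (lookup-zipWith; tabulate∘lookup)
open import Function using (_∘_; Equivalence)
open import Level using (0ℓ)
open import Relation.Binary.PropositionalEquality
  using (_≡_; _≢_; refl; sym; trans; cong; cong₂; subst; subst₂; module ≡-Reasoning)
open import Relation.Binary.Structures using (IsTotalOrder)
open import Relation.Nullary using (yes; no; contradiction; ¬_; Dec)
open import Relation.Nullary.Decidable using (decidable-stable)
open import Relation.Unary using (Pred; _∈_; _∉_; _∪_; ∁; ｛_｝; ∅; U; Empty)
open import Defs

-- The obstacle is change in infinitely many variables. `FVᶠ` and `BV` compare states one variable
-- at a time, but the proof must move a state all the way to `ω₀`, and finitely many updates need
-- not connect the two. For terms this is harmless, since a term reads finitely many variables; a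
-- game symbol may be interpreted by an operator that looks at all of them together. The way out is
-- that `FVᶠ` and `BV` quantify over all interpretations. If a permutation `τ` of the states cannot
-- be noticed by the variables written in an expression, conjugating the game symbols by `τ` gives
-- another interpretation, and what holds for a change of one variable there holds in `I` for a
-- change of many. Free variables need a transposition of two states, bound variables a reflection
-- in one unbound variable that keeps the initial state fixed. Smoothness meets a related
-- difficulty: a differential inside a replacement differentiates along the state, so smoothness in
-- the arguments has to be proved together with smoothness in the state.

-- Arithmetic and absolute values in an ordered field.

module OrderedField (ℛ : Reals) where
  open Analysis ℛ
  open IsTotalOrder isTotalOrder public
    using (total) renaming (refl to ≤-refl; reflexive to ≤-reflexive; trans to ≤-trans; antisym to ≤-antisym)

  private
    ℝ-ring : CommutativeRing 0ℓ 0ℓ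
    ℝ-ring = record { isCommutativeRing = isCommutativeRing }

  open CommutativeRing ℝ-ring public
    using (+-comm; +-identityˡ; +-identityʳ; *-comm; *-assoc; *-identityˡ; -‿inverseʳ; zeroˡ; zeroʳ)
  open RingProperties (CommutativeRing.ring ℝ-ring) public
    using () renaming (-0#≈0# to -0≡0)

  -- The library solvers either ignore negation or need decidable equality of the
  -- ring; with formal differences of naturals as coefficients, x - x = 0 is found.
  module Solver where
    open CommutativeRing ℝ-ring using (semiring; ring; +-abelianGroup; commutativeSemiring)
    open Multiples semiring using (×-homo-+; ×1-homo-*) renaming (_×_ to _·_)
    open RingProperties ring using (-‿distribˡ-*; -‿distribʳ-*; -‿involutive; -0#≈0#)
    open AbelianGroupProperties +-abelianGroup using (⁻¹-∙-comm)
    open ≡-Reasoning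

    module S = SemiringSolver commutativeSemiring
    open S using (_:=_; _:+_; _:*_)

    -- Normal forms are compared syntactically, so coefficients must be reduced.
    reduce : ℕ × ℕ → ℕ × ℕ
    reduce (ℕ.suc a , ℕ.suc b) = reduce (a , b)
    reduce (a       , b)       = a , b

    Differences : RawRing 0ℓ 0ℓ
    Differences = record
      { Carrier = ℕ × ℕ
      ; _≈_     = _≡_
      ; _+_     = λ { (a , b) (c , d) → reduce (a ℕ.+ c , b ℕ.+ d) }
      ; _*_     = λ { (a , b) (c , d) → reduce (a ℕ.* c ℕ.+ b ℕ.* d , a ℕ.* d ℕ.+ b ℕ.* c) }
      ; -_      = λ { (a , b) → b , a }
      ; 0#      = 0 , 0
      ; 1#      = 1 , 0
      }

    embed : ℕ × ℕ → ℝ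
    embed (a , b) = a · 1# - b · 1#

    difference-+ : ∀ w x y z → (w + y) - (x + z) ≡ (w - x) + (y - z)
    difference-+ w x y z = trans (cong (w + y +_) (sym (⁻¹-∙-comm x z)))
      (S.solve 4 (λ w y x z → (w :+ y) :+ (x :+ z) := (w :+ x) :+ (y :+ z)) refl w y (- x) (- z))

    difference-* : ∀ w x y z → (w * y + x * z) - (w * z + x * y) ≡ (w - x) * (y - z)
    difference-* w x y z = begin
      (w * y + x * z) - (w * z + x * y)
        ≡⟨ cong₂ (λ p q → (w * y + p) + q)
                 (trans (sym (-‿involutive _)) (trans (cong -_ (-‿distribˡ-* x z)) (-‿distribʳ-* (- x) z)))
                 (trans (sym (⁻¹-∙-comm (w * z) (x * y))) (cong₂ _+_ (-‿distribʳ-* w z) (-‿distribˡ-* x y))) ⟩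
      (w * y + (- x) * (- z)) + (w * (- z) + (- x) * y)
        ≡⟨ S.solve 4 (λ w x y z → (w :* y :+ x :* z) :+ (w :* z :+ x :* y) := (w :+ x) :* (y :+ z))
             refl w (- x) y (- z) ⟩
      (w - x) * (y - z) ∎

    embed-reduce : ∀ p → embed (reduce p) ≡ embed p
    embed-reduce (ℕ.zero  , b)       = refl
    embed-reduce (ℕ.suc a , ℕ.zero)  = refl
    embed-reduce (ℕ.suc a , ℕ.suc b) = begin
      embed (reduce (a , b))        ≡⟨ embed-reduce (a , b) ⟩
      embed (a , b)                 ≡⟨ sym (+-identityˡ _) ⟩
      0# + embed (a , b)            ≡⟨ cong (_+ embed (a , b)) (sym (-‿inverseʳ 1#)) ⟩
      (1# - 1#) + embed (a , b)     ≡⟨ sym (difference-+ 1# 1# (a · 1#) (b · 1#)) ⟩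
      embed (ℕ.suc a , ℕ.suc b)     ∎

    ×-homo-** : ∀ a b c d → (a ℕ.* b ℕ.+ c ℕ.* d) · 1# ≡ (a · 1#) * (b · 1#) + (c · 1#) * (d · 1#)
    ×-homo-** a b c d = trans (×-homo-+ 1# (a ℕ.* b) (c ℕ.* d)) (cong₂ _+_ (×1-homo-* a b) (×1-homo-* c d))

    embed-homomorphism : Differences -Raw-AlmostCommutative⟶ fromCommutativeRing ℝ-ring
    embed-homomorphism = record
      { ⟦_⟧    = embed
      ; +-homo = λ { (a , b) (c , d) → trans (embed-reduce (a ℕ.+ c , b ℕ.+ d)) (trans
                     (cong₂ _-_ (×-homo-+ 1# a c) (×-homo-+ 1# b d))
                     (difference-+ (a · 1#) (b · 1#) (c · 1#) (d · 1#))) }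
      ; *-homo = λ { (a , b) (c , d) → trans (embed-reduce (a ℕ.* c ℕ.+ b ℕ.* d , a ℕ.* d ℕ.+ b ℕ.* c)) (trans
                     (cong₂ _-_ (×-homo-** a c b d) (×-homo-** a d b c))
                     (difference-* (a · 1#) (b · 1#) (c · 1#) (d · 1#))) }
      ; -‿homo = λ { (a , b) → trans (+-comm _ _) (trans
                     (cong (- (a · 1#) +_) (sym (-‿involutive (b · 1#)))) (⁻¹-∙-comm (a · 1#) (- (b · 1#)))) }
      ; 0-homo = -‿inverseʳ 0#
      ; 1-homo = trans (cong₂ _+_ (+-identityʳ 1#) -0#≈0#) (+-identityʳ 1#)
      }

    _≟ᶜ_ : ∀ p q → Maybe (embed p ≡ embed q)
    (a , b) ≟ᶜ (c , d) with a ℕ.≟ c | b ℕ.≟ d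
    ... | yes refl | yes refl = just refl
    ... | _        | _        = nothing

    open RingSolver Differences (fromCommutativeRing ℝ-ring) embed-homomorphism _≟ᶜ_ public
      using (solve; _:+_; _:*_; _:-_; :-_; _:=_)

  open Solver using (solve; _:+_; _:*_; _:-_; :-_; _:=_)

  <⇒≤ : ∀ {x y} → x < y → x ≤ y
  <⇒≤ (x≤y , _) = x≤y

  <-≤-trans : ∀ {x y z} → x < y → y ≤ z → x < z
  <-≤-trans (x≤y , x≢y) y≤z = ≤-trans x≤y y≤z , λ { refl → x≢y (≤-antisym x≤y y≤z) }

  ≤-<-trans : ∀ {x y z} → x ≤ y → y < z → x < z
  ≤-<-trans x≤y (y≤z , y≢z) = ≤-trans x≤y y≤z , λ { refl → y≢z (≤-antisym y≤z x≤y) }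

  +-mono-≤ : ∀ {w x y z} → w ≤ x → y ≤ z → w + y ≤ x + z
  +-mono-≤ {w} {x} {y} {z} w≤x y≤z = ≤-trans (+-monoˡ-≤ y w≤x)
    (subst₂ _≤_ (+-comm y x) (+-comm z x) (+-monoˡ-≤ x y≤z))

  x≤y⇒0≤y-x : ∀ {x y} → x ≤ y → 0# ≤ y - x
  x≤y⇒0≤y-x {x} x≤y = subst (_≤ _) (-‿inverseʳ x) (+-monoˡ-≤ (- x) x≤y)

  0≤y-x⇒x≤y : ∀ {x y} → 0# ≤ y - x → x ≤ y
  0≤y-x⇒x≤y {x} {y} p = subst₂ _≤_ (+-identityˡ x)
    (solve 2 (λ x y → (y :- x) :+ x := y) refl x y) (+-monoˡ-≤ x p)

  neg-mono-≤ : ∀ {x y} → x ≤ y → - y ≤ - x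
  neg-mono-≤ {x} {y} x≤y = 0≤y-x⇒x≤y
    (subst (0# ≤_) (solve 2 (λ x y → y :- x := :- x :- :- y) refl x y) (x≤y⇒0≤y-x x≤y))

  *-monoˡ-≤ : ∀ {z x y} → 0# ≤ z → x ≤ y → z * x ≤ z * y
  *-monoˡ-≤ {z} {x} {y} 0≤z x≤y = 0≤y-x⇒x≤y
    (subst (0# ≤_) (solve 3 (λ x y z → z :* (y :- x) := z :* y :- z :* x) refl x y z)
      (*-nonNegative 0≤z (x≤y⇒0≤y-x x≤y)))

  *-monoʳ-≤ : ∀ {z x y} → 0# ≤ z → x ≤ y → x * z ≤ y * z
  *-monoʳ-≤ {z} {x} {y} 0≤z x≤y = subst₂ _≤_ (*-comm z x) (*-comm z y) (*-monoˡ-≤ 0≤z x≤y)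

  0≤1 : 0# ≤ 1#
  0≤1 with total 0# 1#
  ... | inj₁ 0≤1 = 0≤1
  ... | inj₂ 1≤0 = subst (0# ≤_)
    (trans (solve 1 (λ x → (:- x) :* (:- x) := x :* x) refl 1#) (*-identityˡ 1#))
    (*-nonNegative 0≤-1 0≤-1)
    where
    0≤-1 : 0# ≤ - 1#
    0≤-1 = subst (_≤ - 1#) -0≡0 (neg-mono-≤ 1≤0)

  0<1 : 0# < 1#
  0<1 = 0≤1 , 0≢1

  0≤x+x⇒0≤x : ∀ {x} → 0# ≤ x + x → 0# ≤ x
  0≤x+x⇒0≤x {x} 0≤x+x with total 0# x
  ... | inj₁ 0≤x = 0≤x
  ... | inj₂ x≤0 = ≤-trans 0≤x+x (subst (x + x ≤_) (+-identityʳ x) (+-mono-≤ ≤-refl x≤0))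

  +-nonNegative : ∀ {x y} → 0# ≤ x → 0# ≤ y → 0# ≤ x + y
  +-nonNegative {x} {y} 0≤x 0≤y = subst (_≤ x + y) (+-identityʳ 0#) (+-mono-≤ 0≤x 0≤y)

  +-positive : ∀ {x y} → 0# < x → 0# ≤ y → 0# < x + y
  +-positive {x} {y} 0<x 0≤y = <-≤-trans 0<x (subst (_≤ x + y) (+-identityʳ x) (+-mono-≤ ≤-refl 0≤y))

  x<x+y : ∀ {x y} → 0# < y → x < x + y
  x<x+y {x} {y} (0≤y , 0≢y) = subst (_≤ x + y) (+-identityʳ x) (+-mono-≤ ≤-refl 0≤y) ,
    λ x≡x+y → 0≢y (trans (sym (-‿inverseʳ x)) (trans (cong (_- x) x≡x+y)
      (solve 2 (λ x y → (x :+ y) :- x := y) refl x y)))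

  reciprocal : ∀ {x} → 0# < x → ∃[ y ] 0# < y × x * y ≡ 1#
  reciprocal {x} (0≤x , 0≢x) with inverse x (λ x≡0 → 0≢x (sym x≡0))
  ... | y , xy≡1 = y , (0≤y , λ { refl → 0≢1 (trans (sym (zeroʳ x)) xy≡1) }) , xy≡1
    where
    0≤y : 0# ≤ y
    0≤y with total 0# y
    ... | inj₁ 0≤y = 0≤y
    ... | inj₂ y≤0 = contradiction (≤-antisym 0≤1 (subst₂ _≤_ xy≡1 (zeroʳ x) (*-monoˡ-≤ 0≤x y≤0))) 0≢1

  *-cancelˡ-≤ : ∀ {z x y} → 0# < z → z * x ≤ z * y → x ≤ y
  *-cancelˡ-≤ {z} {x} {y} 0<z zx≤zy with reciprocal 0<z
  ... | w , 0<w , zw≡1 = subst₂ _≤_ (cancel x) (cancel y) (*-monoˡ-≤ (<⇒≤ 0<w) zx≤zy)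
    where
    cancel : ∀ x → w * (z * x) ≡ x
    cancel x = trans (solve 3 (λ w x z → w :* (z :* x) := (z :* w) :* x) refl w x z)
      (trans (cong (_* x) zw≡1) (*-identityˡ x))

  *-positive : ∀ {x y} → 0# < x → 0# < y → 0# < x * y
  *-positive {x} {y} 0<x (0≤y , 0≢y) = *-nonNegative (<⇒≤ 0<x) 0≤y ,
    λ 0≡xy → 0≢y (≤-antisym 0≤y (*-cancelˡ-≤ 0<x (≤-reflexive (trans (sym 0≡xy) (sym (zeroʳ x))))))

  shrink : ∀ {b ε} → 0# ≤ b → 0# < ε → ∃[ ε′ ] 0# < ε′ × b * ε′ < ε
  shrink {b} {ε} 0≤b 0<ε with reciprocal (+-positive 0<1 0≤b)
  -- The witness is `ε` divided by `1# + b`; the summand `1#` covers `b` equal to zero and makes the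
  -- inequality strict.
  ... | y , 0<y , 1+b*y≡1 = y * ε , *-positive 0<y 0<ε ,
    subst (b * (y * ε) <_)
      (trans (solve 3 (λ b y e → b :* (y :* e) :+ y :* e := (b :* y :+ y) :* e) refl b y ε)
        (trans (cong (_* ε) (trans (cong (b * y +_) (sym (*-identityˡ y)))
          (trans (solve 3 (λ b y o → b :* y :+ o :* y := (o :+ b) :* y) refl b y 1#) 1+b*y≡1))) (*-identityˡ ε)))
      (x<x+y (*-positive 0<y 0<ε))

  common-bound : ∀ {x y} → 0# < x → 0# < y → ∃[ z ] 0# < z × z ≤ x × z ≤ y
  common-bound {x} {y} 0<x 0<y with total x y
  ... | inj₁ x≤y = x , 0<x , ≤-refl , x≤y
  ... | inj₂ y≤x = y , 0<y , y≤x , ≤-refl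

  -- The absolute value is defined by the outcome of `total`, which is not determined at zero, so
  -- both outcomes have to be covered.
  ∣_∣-cases : ∀ x (P : ℝ → Set) → (0# ≤ x → P x) → (x ≤ 0# → P (- x)) → P ∣ x ∣
  ∣ x ∣-cases P nonNeg nonPos with total 0# x
  ... | inj₁ 0≤x = nonNeg 0≤x
  ... | inj₂ x≤0 = nonPos x≤0

  0≤-x : ∀ {x} → x ≤ 0# → 0# ≤ - x
  0≤-x {x} x≤0 = subst (_≤ - x) -0≡0 (neg-mono-≤ x≤0)

  -x≤0 : ∀ {x} → 0# ≤ x → - x ≤ 0#
  -x≤0 {x} 0≤x = subst (- x ≤_) -0≡0 (neg-mono-≤ 0≤x)

  0≤∣x∣ : ∀ x → 0# ≤ ∣ x ∣
  0≤∣x∣ x = ∣ x ∣-cases (0# ≤_) (λ 0≤x → 0≤x) 0≤-x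

  x≤∣x∣ : ∀ x → x ≤ ∣ x ∣
  x≤∣x∣ x = ∣ x ∣-cases (x ≤_) (λ _ → ≤-refl) (λ x≤0 → ≤-trans x≤0 (0≤-x x≤0))

  -x≤∣x∣ : ∀ x → - x ≤ ∣ x ∣
  -x≤∣x∣ x = ∣ x ∣-cases (- x ≤_) (λ 0≤x → ≤-trans (-x≤0 0≤x) 0≤x) (λ _ → ≤-refl)

  ∣x∣≤ : ∀ {x b} → x ≤ b → - x ≤ b → ∣ x ∣ ≤ b
  ∣x∣≤ {x} {b} x≤b -x≤b = ∣ x ∣-cases (_≤ b) (λ _ → x≤b) (λ _ → -x≤b)

  0≤x⇒∣x∣≡x : ∀ {x} → 0# ≤ x → ∣ x ∣ ≡ x
  0≤x⇒∣x∣≡x {x} 0≤x = ≤-antisym (∣x∣≤ ≤-refl (≤-trans (-x≤0 0≤x) 0≤x)) (x≤∣x∣ x)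

  ∣0∣≡0 : ∣ 0# ∣ ≡ 0#
  ∣0∣≡0 = 0≤x⇒∣x∣≡x ≤-refl

  ∣x+y∣≤ : ∀ x y {a b} → ∣ x ∣ ≤ a → ∣ y ∣ ≤ b → ∣ x + y ∣ ≤ a + b
  ∣x+y∣≤ x y ∣x∣≤a ∣y∣≤b = ∣x∣≤
    (+-mono-≤ (≤-trans (x≤∣x∣ x) ∣x∣≤a) (≤-trans (x≤∣x∣ y) ∣y∣≤b))
    (subst (_≤ _) (solve 2 (λ x y → :- x :+ :- y := :- (x :+ y)) refl x y)
      (+-mono-≤ (≤-trans (-x≤∣x∣ x) ∣x∣≤a) (≤-trans (-x≤∣x∣ y) ∣y∣≤b)))

  -- Twice `a * b - x * y` equals `(a - x) * (b + y) + (a + x) * (b - y)`, whose factors are all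
  -- non-negative; exchanging `y` and `- y` gives the other sign.
  ∣x*y∣≤ : ∀ x y {a b} → ∣ x ∣ ≤ a → ∣ y ∣ ≤ b → ∣ x * y ∣ ≤ a * b
  ∣x*y∣≤ x y {a} {b} ∣x∣≤a ∣y∣≤b = ∣x∣≤
    (0≤y-x⇒x≤y (0≤x+x⇒0≤x (subst (0# ≤_)
      (solve 4 (λ x y a b → (a :- x) :* (b :- (:- y)) :+ (a :- (:- x)) :* (b :- y)
                         := (a :* b :- x :* y) :+ (a :* b :- x :* y)) refl x y a b)
      (+-nonNegative (*-nonNegative 0≤a-x 0≤b+y) (*-nonNegative 0≤a+x 0≤b-y)))))
    (0≤y-x⇒x≤y (0≤x+x⇒0≤x (subst (0# ≤_)
      (solve 4 (λ x y a b → (a :- x) :* (b :- y) :+ (a :- (:- x)) :* (b :- (:- y))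
                         := (a :* b :- (:- (x :* y))) :+ (a :* b :- (:- (x :* y)))) refl x y a b)
      (+-nonNegative (*-nonNegative 0≤a-x 0≤b-y) (*-nonNegative 0≤a+x 0≤b+y)))))
    where
    0≤a-x = x≤y⇒0≤y-x (≤-trans (x≤∣x∣ x) ∣x∣≤a)
    0≤a+x = x≤y⇒0≤y-x (≤-trans (-x≤∣x∣ x) ∣x∣≤a)
    0≤b-y = x≤y⇒0≤y-x (≤-trans (x≤∣x∣ y) ∣y∣≤b)
    0≤b+y = x≤y⇒0≤y-x (≤-trans (-x≤∣x∣ y) ∣y∣≤b)

-- Gradients and closure properties of smooth functions.

module Calculus (ℛ : Reals) where
  open Analysis ℛ
  open OrderedField ℛ
  open Solver using (solve; _:+_; _:*_; _:-_; :-_; _:=_)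

  infixl 6 _⊖_
  _⊖_ : ∀ {k} → Vec ℝ k → Vec ℝ k → Vec ℝ k
  _⊖_ = Vec.zipWith _-_

  _∙_ : ∀ {k} → (Fin k → ℝ) → Vec ℝ k → ℝ
  g ∙ h = ∑ (Vec.zipWith _*_ (tabulate g) h)

  0≤∥_∥ : ∀ {k} (h : Vec ℝ k) → 0# ≤ ∥ h ∥
  0≤∥ []    ∥ = ≤-refl
  0≤∥ x ∷ h ∥ = +-nonNegative (0≤∣x∣ x) 0≤∥ h ∥

  ∙-zeroˡ : ∀ {k} (h : Vec ℝ k) → (λ _ → 0#) ∙ h ≡ 0#
  ∙-zeroˡ []      = refl
  ∙-zeroˡ (x ∷ h) = trans (cong₂ _+_ (zeroˡ x) (∙-zeroˡ h)) (+-identityʳ 0#)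

  ∙-*ˡ : ∀ {k} c (g : Fin k → ℝ) (h : Vec ℝ k) → (λ i → c * g i) ∙ h ≡ c * (g ∙ h)
  ∙-*ˡ c g []      = sym (zeroʳ c)
  ∙-*ˡ c g (x ∷ h) = trans
    (cong (c * g zero * x +_) (∙-*ˡ c (λ i → g (suc i)) h))
    (solve 4 (λ c q x G → c :* q :* x :+ c :* G := c :* (q :* x :+ G)) refl c (g zero) x ((λ i → g (suc i)) ∙ h))

  ∙-+ : ∀ {k} (f g : Fin k → ℝ) (h : Vec ℝ k) → (λ i → f i + g i) ∙ h ≡ f ∙ h + g ∙ h
  ∙-+ f g []      = sym (+-identityʳ 0#)
  ∙-+ f g (x ∷ h) = trans
    (cong ((f zero + g zero) * x +_) (∙-+ (λ i → f (suc i)) (λ i → g (suc i)) h))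
    (solve 5 (λ p q x F G → (p :+ q) :* x :+ (F :+ G) := (p :* x :+ F) :+ (q :* x :+ G))
      refl (f zero) (g zero) x ((λ i → f (suc i)) ∙ h) ((λ i → g (suc i)) ∙ h))

  ∙-zeroʳ : ∀ {k} (g : Fin k → ℝ) (v : Vec ℝ k) → g ∙ (v ⊖ v) ≡ 0#
  ∙-zeroʳ g []      = refl
  ∙-zeroʳ g (x ∷ v) = trans
    (cong₂ _+_ (trans (cong (g zero *_) (-‿inverseʳ x)) (zeroʳ (g zero))) (∙-zeroʳ (λ i → g (suc i)) v))
    (+-identityʳ 0#)

  ∥v⊖v∥≡0 : ∀ {k} (v : Vec ℝ k) → ∥ v ⊖ v ∥ ≡ 0#
  ∥v⊖v∥≡0 []      = refl
  ∥v⊖v∥≡0 (x ∷ v) = trans (cong₂ _+_ (trans (cong ∣_∣ (-‿inverseʳ x)) ∣0∣≡0) (∥v⊖v∥≡0 v)) (+-identityʳ 0#)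

  indicator : ∀ {k} → Fin k → Fin k → ℝ
  indicator zero    zero    = 1#
  indicator zero    (suc j) = 0#
  indicator (suc i) zero    = 0#
  indicator (suc i) (suc j) = indicator i j

  indicator-∙ : ∀ {k} (i : Fin k) (h : Vec ℝ k) → indicator i ∙ h ≡ lookup h i
  indicator-∙ zero    (x ∷ h) = trans (cong₂ _+_ (*-identityˡ x) (∙-zeroˡ h)) (+-identityʳ x)
  indicator-∙ (suc i) (x ∷ h) = trans (cong₂ _+_ (zeroˡ x) (indicator-∙ i h)) (+-identityˡ _)

  ∑-∙ : ∀ {k m} (p : Fin k → ℝ) (J : Fin k → Fin m → ℝ) (h : Vec ℝ m) →
        (λ i → ∑ (tabulate λ j → p j * J j i)) ∙ h ≡ ∑ (tabulate λ j → p j * (J j ∙ h))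
  ∑-∙ {zero}  p J h = ∙-zeroˡ h
  ∑-∙ {suc k} p J h = trans (∙-+ _ _ h)
    (cong₂ _+_ (∙-*ˡ (p zero) (J zero) h) (∑-∙ (λ j → p (suc j)) (λ j → J (suc j)) h))

  ∙-difference : ∀ {k} (p u w l : Fin k → ℝ) →
                 p ∙ (tabulate u ⊖ tabulate w) - ∑ (tabulate λ j → p j * l j) ≡
                 ∑ (tabulate λ j → p j * (u j - w j - l j))
  ∙-difference {zero}  p u w l = -‿inverseʳ 0#
  ∙-difference {suc k} p u w l = trans
    (solve 6 (λ p u w l X Y → (p :* (u :- w) :+ X) :- (p :* l :+ Y) := p :* (u :- w :- l) :+ (X :- Y)) refl
      (p zero) (u zero) (w zero) (l zero)
      ((λ j → p (suc j)) ∙ (tabulate (λ j → u (suc j)) ⊖ tabulate (λ j → w (suc j))))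
      (∑ (tabulate λ j → p (suc j) * l (suc j))))
    (cong (p zero * (u zero - w zero - l zero) +_)
      (∙-difference (λ j → p (suc j)) (λ j → u (suc j)) (λ j → w (suc j)) (λ j → l (suc j))))

  -- Both norms are 1-norms: expanding the product of the two sums leaves, besides the wanted terms,
  -- only non-negative cross terms.
  ∣g∙h∣≤∥g∥*∥h∥ : ∀ {k} (g : Fin k → ℝ) (h : Vec ℝ k) → ∣ g ∙ h ∣ ≤ ∥ tabulate g ∥ * ∥ h ∥
  ∣g∙h∣≤∥g∥*∥h∥ g []      = ≤-reflexive (trans ∣0∣≡0 (sym (zeroʳ 0#)))
  ∣g∙h∣≤∥g∥*∥h∥ g (x ∷ h) = ≤-trans
    (∣x+y∣≤ (g zero * x) (g′ ∙ h) (∣x*y∣≤ (g zero) x ≤-refl ≤-refl) (∣g∙h∣≤∥g∥*∥h∥ g′ h))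
    (0≤y-x⇒x≤y (subst (0# ≤_)
      (solve 4 (λ p x G H → p :* H :+ G :* x := (p :+ G) :* (x :+ H) :- (p :* x :+ G :* H))
        refl (∣ g zero ∣) (∣ x ∣) ∥ tabulate g′ ∥ ∥ h ∥)
      (+-nonNegative (*-nonNegative (0≤∣x∣ (g zero)) 0≤∥ h ∥) (*-nonNegative 0≤∥ tabulate g′ ∥ (0≤∣x∣ x)))))
    where
    g′ = λ i → g (suc i)

  Near : ∀ {k} → Vec ℝ k → (Vec ℝ k → Set) → Set
  Near a P = ∃[ δ ] 0# < δ × (∀ v → ∥ v ⊖ a ∥ < δ → P v)

  Near-map₂ : ∀ {k} {a : Vec ℝ k} {P Q R : Vec ℝ k → Set} →
              (∀ v → P v → Q v → R v) → Near a P → Near a Q → Near a R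
  Near-map₂ f (δ₁ , 0<δ₁ , p) (δ₂ , 0<δ₂ , q) with common-bound 0<δ₁ 0<δ₂
  ... | δ , 0<δ , δ≤δ₁ , δ≤δ₂ = δ , 0<δ ,
    λ v v-near → f v (p v (<-≤-trans v-near δ≤δ₁)) (q v (<-≤-trans v-near δ≤δ₂))

  -- e(v) = o(∥v − a∥) and e(v) = O(∥v − a∥) as v → a.
  Small Big : ∀ {k} → Vec ℝ k → (Vec ℝ k → ℝ) → Set
  Small a e = ∀ ε → 0# < ε → Near a (λ v → ∣ e v ∣ ≤ ε * ∥ v ⊖ a ∥)
  Big   a e = ∃[ L ] 0# ≤ L × Near a (λ v → ∣ e v ∣ ≤ L * ∥ v ⊖ a ∥)

  module _ {k} {a : Vec ℝ k} where

    Small-cong : ∀ {e e′} → (∀ v → e v ≡ e′ v) → Small a e → Small a e′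
    Small-cong e≗e′ small ε 0<ε with small ε 0<ε
    ... | δ , 0<δ , p = δ , 0<δ , λ v v-near → subst (λ x → ∣ x ∣ ≤ _) (e≗e′ v) (p v v-near)

    Big-cong : ∀ {e e′} → (∀ v → e v ≡ e′ v) → Big a e → Big a e′
    Big-cong e≗e′ (L , 0≤L , δ , 0<δ , p) =
      L , 0≤L , δ , 0<δ , λ v v-near → subst (λ x → ∣ x ∣ ≤ _) (e≗e′ v) (p v v-near)

    Small-0 : Small a (λ _ → 0#)
    Small-0 ε 0<ε = 1# , 0<1 , λ v _ →
      subst (_≤ ε * ∥ v ⊖ a ∥) (sym ∣0∣≡0) (*-nonNegative (<⇒≤ 0<ε) 0≤∥ v ⊖ a ∥)

    Small-+ : ∀ {e e′} → Small a e → Small a e′ → Small a (λ v → e v + e′ v)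
    Small-+ {e} {e′} small small′ ε 0<ε =
      let ε′ , 0<ε′ , 2ε′<ε = shrink (+-nonNegative 0≤1 0≤1) 0<ε
      in Near-map₂ (add ε′ (<⇒≤ 2ε′<ε)) (small ε′ 0<ε′) (small′ ε′ 0<ε′)
      where
      double : ∀ x y → x * y + x * y ≡ (1# + 1#) * x * y
      double x y = trans (cong₂ _+_ (sym (*-identityˡ _)) (sym (*-identityˡ _)))
        (solve 3 (λ o x y → o :* (x :* y) :+ o :* (x :* y) := (o :+ o) :* x :* y) refl 1# x y)

      add : ∀ ε′ → (1# + 1#) * ε′ ≤ ε → ∀ v → ∣ e v ∣ ≤ ε′ * ∥ v ⊖ a ∥ → ∣ e′ v ∣ ≤ ε′ * ∥ v ⊖ a ∥ →
            ∣ e v + e′ v ∣ ≤ ε * ∥ v ⊖ a ∥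
      add ε′ 2ε′≤ε v p q = ≤-trans (∣x+y∣≤ (e v) (e′ v) p q)
        (≤-trans (≤-reflexive (double ε′ (∥ v ⊖ a ∥))) (*-monoʳ-≤ 0≤∥ v ⊖ a ∥ 2ε′≤ε))

    Small-*ˡ : ∀ c {e} → Small a e → Small a (λ v → c * e v)
    Small-*ˡ c {e} small ε 0<ε =
      let ε′ , 0<ε′ , cε′<ε = shrink (0≤∣x∣ c) 0<ε
          δ , 0<δ , p = small ε′ 0<ε′
      in δ , 0<δ , λ v v-near → ≤-trans (∣x*y∣≤ c (e v) ≤-refl (p v v-near))
        (≤-trans (≤-reflexive (sym (*-assoc ∣ c ∣ ε′ (∥ v ⊖ a ∥)))) (*-monoʳ-≤ 0≤∥ v ⊖ a ∥ (<⇒≤ cε′<ε)))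

    Small⇒Big : ∀ {e} → Small a e → Big a e
    Small⇒Big small = 1# , 0≤1 , small 1# 0<1

    Big-+ : ∀ {e e′} → Big a e → Big a e′ → Big a (λ v → e v + e′ v)
    Big-+ {e} {e′} (L , 0≤L , big) (L′ , 0≤L′ , big′) = L + L′ , +-nonNegative 0≤L 0≤L′ ,
      Near-map₂ (λ v p q → ≤-trans (∣x+y∣≤ (e v) (e′ v) p q)
        (≤-reflexive (solve 3 (λ l l′ x → l :* x :+ l′ :* x := (l :+ l′) :* x) refl L L′ (∥ v ⊖ a ∥)))) big big′

    Big-∙ : ∀ g → Big a (λ v → g ∙ (v ⊖ a))
    Big-∙ g = ∥ tabulate g ∥ , 0≤∥ tabulate g ∥ , 1# , 0<1 , λ v _ → ∣g∙h∣≤∥g∥*∥h∥ g (v ⊖ a)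

    -- The product is at most `L * L′` times the square of the distance; on a small enough
    -- neighbourhood one of the two distances is absorbed into `ε`.
    Big-*-Big : ∀ {e e′} → Big a e → Big a e′ → Small a (λ v → e v * e′ v)
    Big-*-Big {e} {e′} (L , 0≤L , big) (L′ , 0≤L′ , big′) ε 0<ε =
      let δ , 0<δ , LL′δ<ε = shrink (*-nonNegative 0≤L 0≤L′) 0<ε
          δ′ , 0<δ′ , p = Near-map₂ (λ _ → _,_) big big′
          δ″ , 0<δ″ , δ″≤δ , δ″≤δ′ = common-bound 0<δ 0<δ′
      in δ″ , 0<δ″ , λ v v-near → let ∣e∣≤ , ∣e′∣≤ = p v (<-≤-trans v-near δ″≤δ′) in
        ≤-trans (∣x*y∣≤ (e v) (e′ v) ∣e∣≤ ∣e′∣≤) (≤-trans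
          (≤-reflexive (solve 3 (λ l l′ x → (l :* x) :* (l′ :* x) := (l :* l′ :* x) :* x) refl L L′ (∥ v ⊖ a ∥)))
          (*-monoʳ-≤ 0≤∥ v ⊖ a ∥ (≤-trans
            (*-monoˡ-≤ (*-nonNegative 0≤L 0≤L′) (≤-trans (<⇒≤ v-near) δ″≤δ)) (<⇒≤ LL′δ<ε))))

    -- `HasGradient` unfolds to `Small` of the linearisation error, so the increment is a `Small`
    -- error plus a linear part, and the calculus of `Small` and `Big` applies to gradients
    -- directly.
    HasGradient⇒Big : ∀ {f g} → HasGradient f a (tabulate g) → Big a (λ v → f v - f a)
    HasGradient⇒Big {f} {g} grad = Big-cong
      (λ v → solve 2 (λ d l → (d :- l) :+ l := d) refl (f v - f a) (g ∙ (v ⊖ a)))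
      (Big-+ (Small⇒Big grad) (Big-∙ g))

    HasGradient-const : ∀ c → HasGradient (λ _ → c) a (tabulate λ _ → 0#)
    HasGradient-const c = Small-cong
      (λ v → sym (trans (cong₂ _-_ (-‿inverseʳ c) (∙-zeroˡ (v ⊖ a))) (-‿inverseʳ 0#)))
      Small-0

    HasGradient-+ : ∀ {f f′ g g′} → HasGradient f a (tabulate g) → HasGradient f′ a (tabulate g′) →
                    HasGradient (λ v → f v + f′ v) a (tabulate λ i → g i + g′ i)
    HasGradient-+ {f} {f′} {g} {g′} grad grad′ = Small-cong
      (λ v → trans
        (solve 6 (λ x y x′ y′ l l′ → (x :- y :- l) :+ (x′ :- y′ :- l′) := (x :+ x′) :- (y :+ y′) :- (l :+ l′))
          refl (f v) (f a) (f′ v) (f′ a) (g ∙ (v ⊖ a)) (g′ ∙ (v ⊖ a)))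
        (cong (λ l → f v + f′ v - (f a + f′ a) - l) (sym (∙-+ g g′ (v ⊖ a)))))
      (Small-+ grad grad′)

    -- The error of the product splits into the two errors, weighted by the values at `a`, and the
    -- product of the increments, which is `Small` because each increment is `Big`.
    HasGradient-* : ∀ {f f′ g g′} → HasGradient f a (tabulate g) → HasGradient f′ a (tabulate g′) →
                    HasGradient (λ v → f v * f′ v) a (tabulate λ i → f′ a * g i + f a * g′ i)
    HasGradient-* {f} {f′} {g} {g′} grad grad′ = Small-cong
      (λ v → trans
        (solve 6 (λ x y x′ y′ l l′ →
            y′ :* (x :- y :- l) :+ y :* (x′ :- y′ :- l′) :+ (x :- y) :* (x′ :- y′)
            := x :* x′ :- y :* y′ :- (y′ :* l :+ y :* l′))
          refl (f v) (f a) (f′ v) (f′ a) (g ∙ (v ⊖ a)) (g′ ∙ (v ⊖ a)))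
        (cong (λ l → f v * f′ v - f a * f′ a - l) (sym (trans (∙-+ _ _ (v ⊖ a))
          (cong₂ _+_ (∙-*ˡ (f′ a) g (v ⊖ a)) (∙-*ˡ (f a) g′ (v ⊖ a)))))))
      (Small-+ (Small-+ (Small-*ˡ (f′ a) grad) (Small-*ˡ (f a) grad′))
        (Big-*-Big (HasGradient⇒Big {f} {g} grad) (HasGradient⇒Big {f′} {g′} grad′)))

    Small-∑ : ∀ {m} {e : Fin m → Vec ℝ k → ℝ} → (∀ j → Small a (e j)) →
              Small a (λ v → ∑ (tabulate λ j → e j v))
    Small-∑ {zero}  small = Small-0
    Small-∑ {suc m} small = Small-+ (small zero) (Small-∑ (λ j → small (suc j)))

    Big-∣∣ : ∀ {e} → Big a e → Big a (λ v → ∣ e v ∣)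
    Big-∣∣ {e} (L , 0≤L , δ , 0<δ , p) = L , 0≤L , δ , 0<δ , λ v v-near →
      subst (_≤ L * ∥ v ⊖ a ∥) (sym (0≤x⇒∣x∣≡x (0≤∣x∣ (e v)))) (p v v-near)

    Big-∥∥ : ∀ {m} {g : Fin m → Vec ℝ k → ℝ} → (∀ j → Big a (λ v → g j v - g j a)) →
             Big a (λ v → ∥ tabulate (λ j → g j v) ⊖ tabulate (λ j → g j a) ∥)
    Big-∥∥ {zero}  big = Small⇒Big Small-0
    Big-∥∥ {suc m} big = Big-+ (Big-∣∣ (big zero)) (Big-∥∥ (λ j → big (suc j)))

    Small-∘ : ∀ {m} {F : Vec ℝ m → ℝ} (G : Vec ℝ k → Vec ℝ m) → Small (G a) F →
              Big a (λ v → ∥ G v ⊖ G a ∥) → Small a (λ v → F (G v))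
    Small-∘ {F = F} G small (L , 0≤L , δ₁ , 0<δ₁ , big) ε 0<ε =
      let ε′ , 0<ε′ , Lε′<ε = shrink 0≤L 0<ε
          δ , 0<δ , p = small ε′ 0<ε′
          δ₂ , 0<δ₂ , Lδ₂<δ = shrink 0≤L 0<δ
          δ₃ , 0<δ₃ , δ₃≤δ₁ , δ₃≤δ₂ = common-bound 0<δ₁ 0<δ₂
      in δ₃ , 0<δ₃ , λ v v-near →
        let ∥ΔG∥≤ = ≤-trans (x≤∣x∣ _) (big v (<-≤-trans v-near δ₃≤δ₁))
            ∥h∥≤δ₂ = ≤-trans (<⇒≤ v-near) δ₃≤δ₂
        in ≤-trans (p (G v) (≤-<-trans (≤-trans ∥ΔG∥≤ (*-monoˡ-≤ 0≤L ∥h∥≤δ₂)) Lδ₂<δ))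
             (≤-trans (*-monoˡ-≤ (<⇒≤ 0<ε′) ∥ΔG∥≤)
               (≤-trans (≤-reflexive (solve 3 (λ e l x → e :* (l :* x) := l :* e :* x) refl ε′ L (∥ v ⊖ a ∥)))
                 (*-monoʳ-≤ 0≤∥ v ⊖ a ∥ (<⇒≤ Lε′<ε))))

    HasGradient-lookup : ∀ i → HasGradient (λ v → lookup v i) a (tabulate (indicator i))
    HasGradient-lookup i = Small-cong
      (λ v → sym (trans (cong (λ l → lookup v i - lookup a i - l)
          (trans (indicator-∙ i (v ⊖ a)) (lookup-zipWith _-_ i v a)))
        (-‿inverseʳ (lookup v i - lookup a i))))
      Small-0

    -- The error of the composition is the error of `f` at the inner increment, which is `Small`
    -- because that increment is `Big`, plus `p` applied to the errors of the `g j`.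
    HasGradient-∘ : ∀ {m} {f : Vec ℝ m → ℝ} {g : Fin m → Vec ℝ k → ℝ} {p : Fin m → ℝ} {J : Fin m → Fin k → ℝ} →
      HasGradient f (tabulate λ j → g j a) (tabulate p) → (∀ j → HasGradient (g j) a (tabulate (J j))) →
      HasGradient (λ v → f (tabulate λ j → g j v)) a (tabulate λ i → ∑ (tabulate λ j → p j * J j i))
    HasGradient-∘ {f = f} {g} {p} {J} grad-f grad-g = Small-cong
      (λ v → trans (regroup v) (cong (λ l → f (G v) - f (G a) - l) (sym (∑-∙ p J (v ⊖ a)))))
      (Small-+
        (Small-∘ G grad-f (Big-∥∥ (λ j → HasGradient⇒Big {g j} {J j} (grad-g j))))
        (Small-∑ (λ j → Small-*ˡ (p j) (grad-g j))))
      where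
      G : Vec ℝ k → Vec ℝ _
      G v = tabulate λ j → g j v

      regroup : ∀ v →
        (f (G v) - f (G a) - p ∙ (G v ⊖ G a)) +
          ∑ (tabulate λ j → p j * (g j v - g j a - J j ∙ (v ⊖ a))) ≡
        f (G v) - f (G a) - ∑ (tabulate λ j → p j * (J j ∙ (v ⊖ a)))
      regroup v = trans
        (cong (f (G v) - f (G a) - p ∙ (G v ⊖ G a) +_)
          (sym (∙-difference p (λ j → g j v) (λ j → g j a) (λ j → J j ∙ (v ⊖ a)))))
        (solve 3 (λ d x y → (d :- x) :+ (x :- y) := d :- y) refl (f (G v) - f (G a)) (p ∙ (G v ⊖ G a))
          (∑ (tabulate λ j → p j * (J j ∙ (v ⊖ a)))))

  -- The product and chain rules place undifferentiated functions next to derivatives; this lowers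
  -- the former to the order of the latter.
  Differentiable-pred : ∀ n {k} {f : Vec ℝ k → ℝ} → Differentiable (suc n) f → Differentiable n f
  Differentiable-pred zero    _                 = tt
  Differentiable-pred (suc n) (∂f , grad , d∂f) = ∂f , grad , λ i → Differentiable-pred n (d∂f i)

  Differentiable-const : ∀ n {k} c → Differentiable {k} n (λ _ → c)
  Differentiable-const zero    c = tt
  Differentiable-const (suc n) c =
    (λ _ _ → 0#) , (λ a → HasGradient-const c) , λ _ → Differentiable-const n 0#

  Differentiable-lookup : ∀ n {k} (i : Fin k) → Differentiable n (λ v → lookup v i)
  Differentiable-lookup zero    i = tt
  Differentiable-lookup (suc n) i =
    (λ j _ → indicator i j) , (λ a → HasGradient-lookup i) , λ j → Differentiable-const n (indicator i j)

  Differentiable-+ : ∀ n {k} {f f′ : Vec ℝ k → ℝ} → Differentiable n f → Differentiable n f′ →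
                     Differentiable n (λ v → f v + f′ v)
  Differentiable-+ zero    _ _ = tt
  Differentiable-+ (suc n) {f = f} {f′} (∂f , grad , d∂f) (∂f′ , grad′ , d∂f′) =
    (λ i v → ∂f i v + ∂f′ i v) ,
    (λ a → HasGradient-+ {f = f} {f′} {λ i → ∂f i a} {λ i → ∂f′ i a} (grad a) (grad′ a)) ,
    λ i → Differentiable-+ n (d∂f i) (d∂f′ i)

  Differentiable-* : ∀ n {k} {f f′ : Vec ℝ k → ℝ} → Differentiable n f → Differentiable n f′ →
                     Differentiable n (λ v → f v * f′ v)
  Differentiable-* zero    _ _ = tt
  Differentiable-* (suc n) {f = f} {f′} df@(∂f , grad , d∂f) df′@(∂f′ , grad′ , d∂f′) =
    (λ i v → f′ v * ∂f i v + f v * ∂f′ i v) ,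
    (λ a → HasGradient-* {f = f} {f′} {λ i → ∂f i a} {λ i → ∂f′ i a} (grad a) (grad′ a)) ,
    λ i → Differentiable-+ n (Differentiable-* n (Differentiable-pred n df′) (d∂f i))
                             (Differentiable-* n (Differentiable-pred n df) (d∂f′ i))

  Differentiable-∑ : ∀ n {m k} {f : Fin m → Vec ℝ k → ℝ} → (∀ j → Differentiable n (f j)) →
                     Differentiable n (λ v → ∑ (tabulate λ j → f j v))
  Differentiable-∑ n {zero}  df = Differentiable-const n 0#
  Differentiable-∑ n {suc m} df = Differentiable-+ n (df zero) (Differentiable-∑ n (λ j → df (suc j)))

  Differentiable-∘ : ∀ n {m k} {f : Vec ℝ m → ℝ} {g : Fin m → Vec ℝ k → ℝ} →
                     Differentiable n f → (∀ j → Differentiable n (g j)) →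
                     Differentiable n (λ v → f (tabulate λ j → g j v))
  Differentiable-∘ zero    _ _ = tt
  Differentiable-∘ (suc n) {f = f} {g} (∂f , grad , d∂f) dg =
    (λ i v → ∑ (tabulate λ j → ∂f j (tabulate λ j → g j v) * proj₁ (dg j) i v)) ,
    (λ a → HasGradient-∘ {f = f} {g} {λ j → ∂f j (tabulate λ j → g j a)} {λ j i → proj₁ (dg j) i a}
             (grad (tabulate λ j → g j a)) (λ j → proj₁ (proj₂ (dg j)) a)) ,
    λ i → Differentiable-∑ n (λ j → Differentiable-* n
      (Differentiable-∘ n (d∂f j) (λ j → Differentiable-pred n (dg j)))
      (proj₂ (proj₂ (dg j)) i))

  HasGradient⇒HasDerivative : ∀ {k} {f : Vec ℝ (suc k) → ℝ} {g : Fin (suc k) → ℝ} {t v} →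
    HasGradient f (t ∷ v) (tabulate g) → HasDerivative (λ s → f (s ∷ v)) t (g zero)
  HasGradient⇒HasDerivative {f = f} {g} {t} {v} grad ε 0<ε =
    let δ , 0<δ , p = grad ε 0<ε
    in δ , 0<δ , λ s _ s-near → subst₂ (λ l d → ∣ f (s ∷ v) - f (t ∷ v) - l ∣ ≤ ε * d)
         (trans (cong (g zero * (s - t) +_) (∙-zeroʳ (λ i → g (suc i)) v)) (+-identityʳ _))
         (norm s)
         (p (s ∷ v) (subst (_< δ) (sym (norm s)) s-near))
    where
    norm : ∀ s → ∣ s - t ∣ + ∥ v ⊖ v ∥ ≡ ∣ s - t ∣
    norm s = trans (cong (∣ s - t ∣ +_) (∥v⊖v∥≡0 v)) (+-identityʳ _)

  module _ (em : ExcludedMiddle 0ℓ) where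

    arbitrarily-small⇒≤0 : ∀ {x} → (∀ ε → 0# < ε → x ≤ ε + ε) → x ≤ 0#
    arbitrarily-small⇒≤0 {x} x≤2ε with total x 0# | em {0# ≡ x}
    ... | inj₁ x≤0 | _        = x≤0
    ... | inj₂ _   | yes refl = ≤-refl
    ... | inj₂ 0≤x | no 0≢x   =
      let ε , 0<ε , 2ε<x = shrink (+-nonNegative 0≤1 0≤1) (0≤x , 0≢x)
          x≤2*ε = subst (x ≤_)
            (trans (cong₂ _+_ (sym (*-identityˡ ε)) (sym (*-identityˡ ε)))
              (solve 2 (λ o e → o :* e :+ o :* e := (o :+ o) :* e) refl 1# ε))
            (x≤2ε ε 0<ε)
      in contradiction (≤-antisym (<⇒≤ 2ε<x) x≤2*ε) (proj₂ 2ε<x)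

    HasDerivative-unique : ∀ {g t l l′} → HasDerivative g t l → HasDerivative g t l′ → l ≡ l′
    HasDerivative-unique {g} {t} d d′ = ≤-antisym (below d d′) (below d′ d)
      where
      below : ∀ {l l′} → HasDerivative g t l → HasDerivative g t l′ → l ≤ l′
      below {l} {l′} d d′ = 0≤y-x⇒x≤y (subst (0# ≤_)
          (solve 2 (λ l l′ → :- (l :- l′) := l′ :- l) refl l l′)
          (0≤-x (arbitrarily-small⇒≤0 bound)))
        where
        bound : ∀ ε → 0# < ε → l - l′ ≤ ε + ε
        bound ε 0<ε =
          let δ₁ , 0<δ₁ , p = d ε 0<ε
              δ₂ , 0<δ₂ , p′ = d′ ε 0<ε
              δ , 0<δ , δ≤δ₁ , δ≤δ₂ = common-bound 0<δ₁ 0<δ₂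
              -- A nonzero step strictly inside both neighbourhoods; the two slopes are compared at
              -- `t + η`, and `η` is cancelled at the end.
              η , 0<η , 1*η<δ = shrink 0≤1 0<δ
              s = t + η
              s-t≡η : s - t ≡ η
              s-t≡η = solve 2 (λ t η → t :+ η :- t := η) refl t η
              ∣s-t∣≡η = trans (cong ∣_∣ s-t≡η) (0≤x⇒∣x∣≡x (<⇒≤ 0<η))
              s-near = subst (_< δ) (trans (*-identityˡ η) (sym ∣s-t∣≡η)) 1*η<δ
              Δ = g s - g t
          in *-cancelˡ-≤ 0<η (subst₂ _≤_
               (trans (solve 4 (λ D x l l′ → :- (D :- l :* x) :+ (D :- l′ :* x) := x :* (l :- l′)) refl
                   Δ (s - t) l l′)
                 (cong (_* (l - l′)) s-t≡η))
               (trans (solve 2 (λ e x → e :* x :+ e :* x := x :* (e :+ e)) refl ε (∣ s - t ∣))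
                 (cong (_* (ε + ε)) ∣s-t∣≡η))
               (+-mono-≤
                 (≤-trans (-x≤∣x∣ (Δ - l * (s - t))) (p s _ (<-≤-trans s-near δ≤δ₁)))
                 (≤-trans (x≤∣x∣ (Δ - l′ * (s - t))) (p′ s _ (<-≤-trans s-near δ≤δ₂)))))

-- Partial derivatives, differentials and the values of terms.

module TermSemantics (ℛ : Reals) (em : ExcludedMiddle 0ℓ) (ext : Extensionality 0ℓ 0ℓ) (ℒ : Language) where
  open dGL ℛ em ℒ
  open OrderedField ℛ
  open Calculus ℛ
  open Solver using (solve; _:+_; _:=_)
  open DecMembership _≟ᵛ_ using (_∈?_)

  update-same : ∀ ω x {r} → (ω [ x ↦ r ]) x ≡ r
  update-same ω x with x ≟ᵛ x
  ... | yes _  = refl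
  ... | no x≢x = contradiction refl x≢x

  update-other : ∀ ω {x y r} → y ≢ x → (ω [ x ↦ r ]) y ≡ ω y
  update-other ω {x} {y} y≢x with y ≟ᵛ x
  ... | yes y≡x = contradiction y≡x y≢x
  ... | no _    = refl

  update-cong : ∀ {ω ν : State} x {r y} → (y ≢ x → ω y ≡ ν y) → (ω [ x ↦ r ]) y ≡ (ν [ x ↦ r ]) y
  update-cong x {y = y} ω≗ν with y ≟ᵛ x
  ... | yes _  = refl
  ... | no y≢x = ω≗ν y≢x

  update-id : ∀ ω x {r} → ω x ≡ r → ω [ x ↦ r ] ≡ ω
  update-id ω x ωx≡r = ext λ y → helper y
    where
    helper : ∀ y → (ω [ x ↦ _ ]) y ≡ ω y
    helper y with y ≟ᵛ x
    ... | yes refl = sym ωx≡r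
    ... | no _     = refl

  -- Excluded middle hands out some derivative; uniqueness makes it the expected one.
  ∂-value : ∀ {F x ω l} → HasDerivative (λ r → F (ω [ x ↦ r ])) (ω x) l → ∂ F x ω ≡ l
  ∂-value {F} {x} {ω} d with em {∃[ l ] HasDerivative (λ r → F (ω [ x ↦ r ])) (ω x) l}
  ... | yes (_ , d′) = HasDerivative-unique em d′ d
  ... | no ¬d        = contradiction (_ , d) ¬d

  ∂-junk : ∀ {F x ω} → ¬ (∃[ l ] HasDerivative (λ r → F (ω [ x ↦ r ])) (ω x) l) → ∂ F x ω ≡ 0#
  ∂-junk {F} {x} {ω} ¬d with em {∃[ l ] HasDerivative (λ r → F (ω [ x ↦ r ])) (ω x) l}
  ... | yes d = contradiction d ¬d
  ... | no _  = refl

  ∂-cong : ∀ {F G x ω ν} → (∀ r → F (ω [ x ↦ r ]) ≡ G (ν [ x ↦ r ])) → ω x ≡ ν x → ∂ F x ω ≡ ∂ G x ν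
  ∂-cong {F} {G} {x} {ω} {ν} F≗G ωx≡νx with em {∃[ l ] HasDerivative (λ r → F (ω [ x ↦ r ])) (ω x) l}
  ... | yes (l , d) = sym (∂-value {G} (subst₂ (λ f t → HasDerivative f t l) (ext F≗G) ωx≡νx d))
  ... | no ¬d       = sym (∂-junk {G} λ { (l , d) → ¬d (l ,
          subst₂ (λ f t → HasDerivative f t l) (sym (ext F≗G)) (sym ωx≡νx) d) })

  ∂-const : ∀ {F x ω c} → (∀ r → F (ω [ x ↦ r ]) ≡ c) → ∂ F x ω ≡ 0#
  ∂-const {F} {x} {ω} {c} F≗c = ∂-value {F} (subst (λ f → HasDerivative f (ω x) 0#) (sym (ext F≗c))
    (HasGradient⇒HasDerivative {f = λ _ → c} {λ _ → 0#} {v = []} (HasGradient-const c)))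

  ∑ˡ : (𝒱 → ℝ) → List 𝒱 → ℝ
  ∑ˡ h xs = List.foldr _+_ 0# (List.map h xs)

  _SupportedIn_ : (𝒱 → ℝ) → List 𝒱 → Set
  h SupportedIn xs = ∀ x → x ∉ˡ xs → h x ≡ 0#

  ∑ˡ-0 : ∀ {h} xs → (∀ x → h x ≡ 0#) → ∑ˡ h xs ≡ 0#
  ∑ˡ-0 []       h≗0 = refl
  ∑ˡ-0 (x ∷ xs) h≗0 = trans (cong₂ _+_ (h≗0 x) (∑ˡ-0 xs h≗0)) (+-identityʳ 0#)

  ∑ˡ-update-∉ : ∀ h {x r} xs → All (x ≢_) xs → ∑ˡ (h [ x ↦ r ]) xs ≡ ∑ˡ h xs
  ∑ˡ-update-∉ h []       All.[]            = refl
  ∑ˡ-update-∉ h (y ∷ xs) (x≢y All.∷ x∉xs) =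
    cong₂ _+_ (update-other h (x≢y ∘ sym)) (∑ˡ-update-∉ h xs x∉xs)

  ∑ˡ-split : ∀ h {x xs} → Unique xs → x ∈ˡ xs → ∑ˡ h xs ≡ h x + ∑ˡ (h [ x ↦ 0# ]) xs
  ∑ˡ-split h {x} {y ∷ xs} (y∉xs ∷ xs!) (here refl) = cong (h x +_) (sym (trans
    (cong₂ _+_ (update-same h x) (∑ˡ-update-∉ h xs y∉xs)) (+-identityˡ _)))
  ∑ˡ-split h {x} {y ∷ xs} (y∉xs ∷ xs!) (there x∈xs) = trans
    (cong₂ _+_ (sym (update-other h (All.lookup y∉xs x∈xs))) (∑ˡ-split h xs! x∈xs))
    (solve 3 (λ a b c → a :+ (b :+ c) := b :+ (a :+ c)) refl
      ((h [ x ↦ 0# ]) y) (h x) (∑ˡ (h [ x ↦ 0# ]) xs))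

  -- Induction on `xs`. If the head occurs in `ys`, it is not deleted there; instead `h` is set to
  -- zero at it, which leaves `ys` a support and makes the tail of `xs` one. Otherwise `h` already
  -- vanishes at the head.
  ∑ˡ-unique : ∀ {h xs ys} → Unique xs → Unique ys → h SupportedIn xs → h SupportedIn ys → ∑ˡ h xs ≡ ∑ˡ h ys
  ∑ˡ-unique {h} {[]} {ys} _ _ supp _ = sym (∑ˡ-0 ys (λ x → supp x (λ ())))
  ∑ˡ-unique {h} {x ∷ xs} {ys} (x∉xs ∷ xs!) ys! supp supp′ with x ∈? ys
  ... | yes x∈ys = trans
    (cong (h x +_) (trans (sym (∑ˡ-update-∉ h xs x∉xs))
      (∑ˡ-unique xs! ys! (λ y → supp-xs y (y ≟ᵛ x)) (λ y → supp-ys y (y ≟ᵛ x)))))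
    (sym (∑ˡ-split h ys! x∈ys))
    where
    supp-xs : ∀ y → _ → y ∉ˡ xs → (h [ x ↦ 0# ]) y ≡ 0#
    supp-xs y (yes refl) _    = update-same h x
    supp-xs y (no y≢x)   y∉xs = trans (update-other h y≢x)
      (supp y λ { (here y≡x) → y≢x y≡x ; (there y∈xs) → y∉xs y∈xs })

    supp-ys : ∀ y → _ → y ∉ˡ ys → (h [ x ↦ 0# ]) y ≡ 0#
    supp-ys y (yes refl) _    = update-same h x
    supp-ys y (no y≢x)   y∉ys = trans (update-other h y≢x) (supp′ y y∉ys)
  ... | no x∉ys = trans (cong₂ _+_ (supp′ x x∉ys) refl)
    (trans (+-identityˡ _) (∑ˡ-unique xs! ys! supp-xs supp′))
    where
    supp-xs : h SupportedIn xs
    supp-xs y y∉xs with y ≟ᵛ x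
    ... | yes refl = supp′ x x∉ys
    ... | no y≢x   = supp y λ { (here y≡x) → y≢x y≡x ; (there y∈xs) → y∉xs y∈xs }

  ∑𝒱-value : ∀ {h xs} → Unique xs → h SupportedIn xs → ∑𝒱 h ≡ ∑ˡ h xs
  ∑𝒱-value {h} {xs} xs! supp with em {∃[ xs ] Unique xs × (∀ x → x ∉ˡ xs → h x ≡ 0#)}
  ... | yes (ys , ys! , supp′) = ∑ˡ-unique ys! xs! supp′ supp
  ... | no ¬finite             = contradiction (xs , xs! , supp) ¬finite

  -- Coincidence for terms, with the finite list of variables that a term reads.

  varsᵗ  : Term → List 𝒱
  varsᵗˢ : ∀ {k} → Vec Term k → List 𝒱

  varsᵗ (var x)    = x ∷ []
  varsᵗ (app f θs) = varsᵗˢ θs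
  varsᵗ (θ ⊕ η)    = varsᵗ θ ++ varsᵗ η
  varsᵗ (θ ⊙ η)    = varsᵗ θ ++ varsᵗ η
  varsᵗ (D θ)      = varsᵗ θ ++ List.map _′ (varsᵗ θ)

  varsᵗˢ []       = []
  varsᵗˢ (θ ∷ θs) = varsᵗ θ ++ varsᵗˢ θs

  AgreeOn : List 𝒱 → State → State → Set
  AgreeOn xs = Agree (_∈ˡ xs)

  FunsCoincide : Pred Symbol 0ℓ → Interpretation → Interpretation → Set
  FunsCoincide S I J = ∀ {k} (f : FunSym k) → funˢ f ∈ S → ∀ v → funᴵ I f v ≡ funᴵ J f v

  coincidenceᵗ : ∀ θ {I J ω ν} → FunsCoincide (Σᵗ θ) I J → AgreeOn (varsᵗ θ) ω ν → ⟦ θ ⟧ᵗ I ω ≡ ⟦ θ ⟧ᵗ J ν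
  coincidenceᵗˢ : ∀ {k} (θs : Vec Term k) {I J ω ν} → FunsCoincide (Σᵗˢ θs) I J → AgreeOn (varsᵗˢ θs) ω ν →
                  ⟦ θs ⟧ᵗˢ I ω ≡ ⟦ θs ⟧ᵗˢ J ν

  ∂⟦⟧-zero : ∀ θ {I x ω} → x ∉ˡ varsᵗ θ → ∂ (⟦ θ ⟧ᵗ I) x ω ≡ 0#

  coincidenceᵗ (var x)    I≈J ω≈ν = ω≈ν x (here refl)
  coincidenceᵗ (app f θs) {I} I≈J ω≈ν = trans
    (cong (funᴵ I f) (coincidenceᵗˢ θs (λ f → I≈J f ∘ inj₂) ω≈ν))
    (I≈J f (inj₁ refl) _)
  coincidenceᵗ (θ ⊕ η)    I≈J ω≈ν = cong₂ _+_
    (coincidenceᵗ θ (λ f → I≈J f ∘ inj₁) (λ x → ω≈ν x ∘ ∈-++⁺ˡ))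
    (coincidenceᵗ η (λ f → I≈J f ∘ inj₂) (λ x → ω≈ν x ∘ ∈-++⁺ʳ (varsᵗ θ)))
  coincidenceᵗ (θ ⊙ η)    I≈J ω≈ν = cong₂ _*_
    (coincidenceᵗ θ (λ f → I≈J f ∘ inj₁) (λ x → ω≈ν x ∘ ∈-++⁺ˡ))
    (coincidenceᵗ η (λ f → I≈J f ∘ inj₂) (λ x → ω≈ν x ∘ ∈-++⁺ʳ (varsᵗ θ)))
  coincidenceᵗ (D θ) {I} {J} {ω} {ν} I≈J ω≈ν = cong ∑𝒱 (ext λ x → term x (x ∈? varsᵗ θ))
    where
    term : ∀ x → _ → ω (x ′) * ∂ (⟦ θ ⟧ᵗ I) x ω ≡ ν (x ′) * ∂ (⟦ θ ⟧ᵗ J) x ν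
    term x (yes x∈θ) = cong₂ _*_ (ω≈ν (x ′) (∈-++⁺ʳ (varsᵗ θ) (∈-map⁺ _′ x∈θ)))
      (∂-cong {⟦ θ ⟧ᵗ I} {⟦ θ ⟧ᵗ J}
        (λ r → coincidenceᵗ θ I≈J (λ y y∈θ → update-cong x (λ _ → ω≈ν y (∈-++⁺ˡ y∈θ))))
        (ω≈ν x (∈-++⁺ˡ x∈θ)))
    -- Here `ω (x ′)` and `ν (x ′)` may differ, so both summands have to vanish, by their partial
    -- derivatives.
    term x (no x∉θ) = trans (trans (cong (ω (x ′) *_) (∂⟦⟧-zero θ x∉θ)) (zeroʳ _))
      (sym (trans (cong (ν (x ′) *_) (∂⟦⟧-zero θ x∉θ)) (zeroʳ _)))

  coincidenceᵗˢ []       I≈J ω≈ν = refl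
  coincidenceᵗˢ (θ ∷ θs) I≈J ω≈ν = cong₂ _∷_
    (coincidenceᵗ θ (λ f → I≈J f ∘ inj₁) (λ x → ω≈ν x ∘ ∈-++⁺ˡ))
    (coincidenceᵗˢ θs (λ f → I≈J f ∘ inj₂) (λ x → ω≈ν x ∘ ∈-++⁺ʳ (varsᵗ θ)))

  ∂⟦⟧-zero θ {I} {x} {ω} x∉θ = ∂-const {⟦ θ ⟧ᵗ I} {c = ⟦ θ ⟧ᵗ I ω} λ r →
    coincidenceᵗ θ (λ _ _ _ → refl) λ y y∈θ → update-other ω λ { refl → x∉θ y∈θ }

  overwrite : List 𝒱 → State → State → State
  overwrite xs ω ν = List.foldr (λ x s → s [ x ↦ ν x ]) ω xs

  overwrite-∈ : ∀ xs ω ν {x} → x ∈ˡ xs → overwrite xs ω ν x ≡ ν x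
  overwrite-∈ (y ∷ xs) ω ν {x} x∈ with x ≟ᵛ y | x∈
  ... | yes refl | _           = refl
  ... | no x≢y   | here x≡y    = contradiction x≡y x≢y
  ... | no _     | there x∈xs  = overwrite-∈ xs ω ν x∈xs

  overwrite-≡ : ∀ xs ω ν {x} → ω x ≡ ν x → overwrite xs ω ν x ≡ ν x
  overwrite-≡ []       ω ν eq = eq
  overwrite-≡ (y ∷ xs) ω ν {x} eq with x ≟ᵛ y
  ... | yes refl = refl
  ... | no _     = overwrite-≡ xs ω ν eq

  overwrite-∉ : ∀ xs ω ν {x} → x ∉ˡ xs → overwrite xs ω ν x ≡ ω x
  overwrite-∉ []       ω ν x∉ = refl
  overwrite-∉ (y ∷ xs) ω ν {x} x∉ with x ≟ᵛ y
  ... | yes x≡y = contradiction (here x≡y) x∉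
  ... | no _    = overwrite-∉ xs ω ν (x∉ ∘ there)

  -- The variables are overwritten one at a time: inside `V` the update changes nothing because the
  -- states agree there, outside `V` it is ignored by `f`.
  overwrite-invariant : ∀ {A : Set} (f : State → A) {V : Pred 𝒱 0ℓ} →
    (∀ x → x ∉ V → ∀ s r → f (s [ x ↦ r ]) ≡ f s) →
    ∀ xs {ω ν} → Agree V ω ν → f (overwrite xs ω ν) ≡ f ω
  overwrite-invariant f     inv []       ω≈ν = refl
  overwrite-invariant f {V} inv (x ∷ xs) {ω} {ν} ω≈ν with em {x ∈ V}
  ... | yes x∈V = trans
    (cong f (update-id _ x (overwrite-≡ xs ω ν (ω≈ν x x∈V)))) (overwrite-invariant f inv xs ω≈ν)
  ... | no x∉V  = trans (inv x x∉V _ _) (overwrite-invariant f inv xs ω≈ν)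

  -- It suffices to overwrite the finitely many variables in `varsᵗ θ`, so invariance under single
  -- updates is enough; syntactic coincidence takes care of all others.
  FVᵗ-coincidence : ∀ θ {I ω ν} → Agree (FVᵗ θ) ω ν → ⟦ θ ⟧ᵗ I ω ≡ ⟦ θ ⟧ᵗ I ν
  FVᵗ-coincidence θ {I} {ω} {ν} ω≈ν = trans
    (sym (overwrite-invariant (⟦ θ ⟧ᵗ I) invariant (varsᵗ θ) ω≈ν))
    (coincidenceᵗ θ (λ _ _ _ → refl) λ x → overwrite-∈ (varsᵗ θ) ω ν)
    where
    invariant : ∀ x → x ∉ FVᵗ θ → ∀ s r → ⟦ θ ⟧ᵗ I (s [ x ↦ r ]) ≡ ⟦ θ ⟧ᵗ I s
    invariant x x∉FV s r with em {⟦ θ ⟧ᵗ I (s [ x ↦ r ]) ≡ ⟦ θ ⟧ᵗ I s}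
    ... | yes eq = eq
    ... | no neq = contradiction (I , s [ x ↦ r ] , s , (λ y y≢x → update-other s (y≢x ∘ sym)) , neq) x∉FV

  -- Smooth dependence of term values on parameters.

  Smooth-const : ∀ {k} c → Smooth {k} (λ _ → c)
  Smooth-const c n = Differentiable-const n c

  Smooth-lookup : ∀ {k} (i : Fin k) → Smooth (λ v → lookup v i)
  Smooth-lookup i n = Differentiable-lookup n i

  Smooth-+ : ∀ {k} {f g : Vec ℝ k → ℝ} → Smooth f → Smooth g → Smooth (λ v → f v + g v)
  Smooth-+ f∞ g∞ n = Differentiable-+ n (f∞ n) (g∞ n)

  Smooth-* : ∀ {k} {f g : Vec ℝ k → ℝ} → Smooth f → Smooth g → Smooth (λ v → f v * g v)
  Smooth-* f∞ g∞ n = Differentiable-* n (f∞ n) (g∞ n)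

  Smooth-∘ : ∀ {m k} {f : Vec ℝ m → ℝ} {g : Fin m → Vec ℝ k → ℝ} {G : Vec ℝ k → Vec ℝ m} →
             (∀ v → tabulate (λ j → g j v) ≡ G v) →
             Smooth f → (∀ j → Smooth (g j)) → Smooth (λ v → f (G v))
  Smooth-∘ {f = f} eq f∞ g∞ n = subst (Differentiable n) (ext λ v → cong f (eq v))
    (Differentiable-∘ n (f∞ n) (λ j → g∞ j n))

  Smooth-tail : ∀ {k} {f : Vec ℝ k → ℝ} → Smooth f → Smooth (λ v → f (Vec.tail v))
  Smooth-tail f∞ = Smooth-∘ {g = λ j v → lookup v (suc j)} (λ { (x ∷ v) → tabulate∘lookup v })
    f∞ (λ j → Smooth-lookup (suc j))

  Smooth-∑ˡ : ∀ {k} xs {h : 𝒱 → Vec ℝ k → ℝ} → (∀ x → Smooth (h x)) → Smooth (λ v → ∑ˡ (λ x → h x v) xs)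
  Smooth-∑ˡ []       h∞ = Smooth-const 0#
  Smooth-∑ˡ (x ∷ xs) h∞ = Smooth-+ (h∞ x) (Smooth-∑ˡ xs h∞)

  -- ∂F/∂x along a smooth family of states is a first partial derivative of the
  -- family extended by one parameter, the value of x.
  Smooth-∂ : ∀ {k} {F : Vec ℝ k → State → ℝ} {s : Vec ℝ k → State} {x} →
             Smooth {suc k} (λ v → F (Vec.tail v) (s (Vec.tail v) [ x ↦ Vec.head v ])) →
             Smooth (λ v → s v x) → Smooth (λ v → ∂ (F v) x (s v))
  Smooth-∂ {k} {F} {s} {x} G∞ sx∞ n with G∞ (suc n)
  ... | ∂G , grad , d∂G = subst (Differentiable n)
    (ext λ v → trans (cong (∂G zero) (cong (s v x ∷_) (tabulate∘lookup v)))
      (sym (∂-value {F v} (HasGradient⇒HasDerivative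
        {f = λ v → F (Vec.tail v) (s (Vec.tail v) [ x ↦ Vec.head v ])} 
        {λ i → ∂G i (s v x ∷ v)} (grad (s v x ∷ v))))))
    (Differentiable-∘ n {g = param} (d∂G zero) param∞)
    where
    param : Fin (suc k) → Vec ℝ k → ℝ
    param zero    v = s v x
    param (suc i) v = lookup v i

    param∞ : ∀ j → Differentiable n (param j)
    param∞ zero    = sx∞ n
    param∞ (suc i) = Differentiable-lookup n i

  _[·≔_] : Interpretation → (ℕ → ℝ) → Interpretation
  I [·≔ ρ ] = record
    { funᴵ   = λ { (fun f) → funᴵ I (fun f) ; (dot i) _ → ρ i }
    ; smooth = λ { (fun f) → smooth I (fun f) ; (dot i) → Smooth-const (ρ i) }
    ; predᴵ  = predᴵ I
    ; gameᴵ  = gameᴵ I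
    ; mono   = mono I
    }

  -- The state has to vary along with the dots: for `D θ` the induction hypothesis is used with one
  -- more parameter, the value of the variable of differentiation. This is why `k`, `ρ` and `s` are
  -- general.
  Smooth-⟦⟧ᵗ : ∀ θ {I k} {ρ : Vec ℝ k → ℕ → ℝ} {s : Vec ℝ k → State} →
               (∀ i → Smooth (λ v → ρ v i)) → (∀ x → Smooth (λ v → s v x)) →
               Smooth (λ v → ⟦ θ ⟧ᵗ (I [·≔ ρ v ]) (s v))
  Smooth-⟦⟧ᵗˢ : ∀ {m} (θs : Vec Term m) {I k} {ρ : Vec ℝ k → ℕ → ℝ} {s : Vec ℝ k → State} →
                (∀ i → Smooth (λ v → ρ v i)) → (∀ x → Smooth (λ v → s v x)) →
                ∀ j → Smooth (λ v → lookup (⟦ θs ⟧ᵗˢ (I [·≔ ρ v ]) (s v)) j)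

  Smooth-⟦⟧ᵗ (var x)          ρ∞ s∞ = s∞ x
  Smooth-⟦⟧ᵗ (app (fun f) θs) {I} {ρ = ρ} {s} ρ∞ s∞ = Smooth-∘
    {g = λ j v → lookup (⟦ θs ⟧ᵗˢ (I [·≔ ρ v ]) (s v)) j}
    (λ v → tabulate∘lookup _) (smooth I (fun f)) (Smooth-⟦⟧ᵗˢ θs ρ∞ s∞)
  Smooth-⟦⟧ᵗ (app (dot i) θs) ρ∞ s∞ = ρ∞ i
  Smooth-⟦⟧ᵗ (θ ⊕ η)          ρ∞ s∞ = Smooth-+ (Smooth-⟦⟧ᵗ θ ρ∞ s∞) (Smooth-⟦⟧ᵗ η ρ∞ s∞)
  Smooth-⟦⟧ᵗ (θ ⊙ η)          ρ∞ s∞ = Smooth-* (Smooth-⟦⟧ᵗ θ ρ∞ s∞) (Smooth-⟦⟧ᵗ η ρ∞ s∞)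
  -- `∑𝒱` may choose a different list for every `v`; a sum over the one list `xs` is needed to
  -- differentiate it term by term.
  Smooth-⟦⟧ᵗ (D θ) {I} {k} {ρ} {s} ρ∞ s∞ = subst Smooth (ext λ v → sym (∑𝒱-value xs! (supported v)))
    (Smooth-∑ˡ xs {λ x v → s v (x ′) * ∂ (⟦ θ ⟧ᵗ (I [·≔ ρ v ])) x (s v)} λ x → Smooth-* (s∞ (x ′))
      (Smooth-∂ {F = λ v → ⟦ θ ⟧ᵗ (I [·≔ ρ v ])} {s}
        (Smooth-⟦⟧ᵗ θ {ρ = λ v → ρ (Vec.tail v)} (λ i → Smooth-tail (ρ∞ i)) (update∞ x)) (s∞ x)))
    where
    xs : List 𝒱
    xs = deduplicate _≟ᵛ_ (varsᵗ θ)

    xs! : Unique xs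
    xs! = deduplicate-! _≟ᵛ_ (varsᵗ θ)

    supported : ∀ v → (λ x → s v (x ′) * ∂ (⟦ θ ⟧ᵗ (I [·≔ ρ v ])) x (s v)) SupportedIn xs
    supported v x x∉xs = trans
      (cong (s v (x ′) *_) (∂⟦⟧-zero θ (x∉xs ∘ ∈-deduplicate⁺ _≟ᵛ_)))
      (zeroʳ _)

    update∞ : ∀ x y → Smooth {suc k} (λ v → (s (Vec.tail v) [ x ↦ Vec.head v ]) y)
    update∞ x y with y ≟ᵛ x
    ... | yes _ = subst Smooth (ext λ { (r ∷ v) → refl }) (Smooth-lookup zero)
    ... | no _  = Smooth-tail (s∞ y)

  Smooth-⟦⟧ᵗˢ (θ ∷ θs) ρ∞ s∞ zero    = Smooth-⟦⟧ᵗ θ ρ∞ s∞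
  Smooth-⟦⟧ᵗˢ (θ ∷ θs) ρ∞ s∞ (suc j) = Smooth-⟦⟧ᵗˢ θs ρ∞ s∞ j

-- Formulas and games: monotonicity, coincidence and symmetries.

module GameSemantics (ℛ : Reals) (em : ExcludedMiddle 0ℓ) (ext : Extensionality 0ℓ 0ℓ) (ℒ : Language) where
  open dGL ℛ em ℒ
  open OrderedField ℛ
  open TermSemantics ℛ em ext ℒ
  open Solver using (solve; _:+_; _:-_; _:=_)
  open DecMembership _≟ᵛ_ using (_∈?_)

  T-ext : ∀ {b c} → (T b → T c) → (T c → T b) → b ≡ c
  T-ext {false} {false} _ _ = refl
  T-ext {false} {true}  _ g = ⊥-elim (g tt)
  T-ext {true}  {false} f _ = ⊥-elim (f tt)
  T-ext {true}  {true}  _ _ = refl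

  module _ {A : Set} where

    ⟪⟫⁺ : ∀ (P : Pred A 0ℓ) {a} → P a → a ∈ᵖ ⟪ P ⟫
    ⟪⟫⁺ P {a} p with em {P a}
    ... | yes _ = tt
    ... | no ¬p = contradiction p ¬p

    ⟪⟫⁻ : ∀ (P : Pred A 0ℓ) {a} → a ∈ᵖ ⟪ P ⟫ → P a
    ⟪⟫⁻ P {a} a∈ with em {P a}
    ... | yes p = p

    ⟪⟫-≡ : ∀ (P Q : Pred A 0ℓ) {a b} → (P a → Q b) → (Q b → P a) → ⟪ P ⟫ a ≡ ⟪ Q ⟫ b
    ⟪⟫-≡ P Q f g = T-ext (⟪⟫⁺ Q ∘ f ∘ ⟪⟫⁻ P) (⟪⟫⁺ P ∘ g ∘ ⟪⟫⁻ Q)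

    ∁⁺ : ∀ {X : 𝒫 A} {a} → a ∉ᵖ X → a ∈ᵖ ∁ᵖ X
    ∁⁺ {X} {a} a∉X with X a
    ... | true  = a∉X tt
    ... | false = tt

    ∁⁻ : ∀ {X : 𝒫 A} {a} → a ∈ᵖ ∁ᵖ X → a ∉ᵖ X
    ∁⁻ {X} {a} a∈∁X a∈X with X a
    ... | true = a∈∁X

    ∁-anti : ∀ {X Y : 𝒫 A} → X ⊆ᵖ Y → ∁ᵖ Y ⊆ᵖ ∁ᵖ X
    ∁-anti {X} {Y} X⊆Y a∈∁Y = ∁⁺ {X} (∁⁻ {Y} a∈∁Y ∘ X⊆Y)

    ∪⁺ : ∀ (X Y : 𝒫 A) {a} → a ∈ᵖ X ⊎ a ∈ᵖ Y → a ∈ᵖ (X ∪ᵖ Y)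
    ∪⁺ X Y = Equivalence.from T-∨

    ∪⁻ : ∀ (X Y : 𝒫 A) {a} → a ∈ᵖ (X ∪ᵖ Y) → a ∈ᵖ X ⊎ a ∈ᵖ Y
    ∪⁻ X Y = Equivalence.to T-∨

    ∩⁺ : ∀ (X Y : 𝒫 A) {a} → a ∈ᵖ X × a ∈ᵖ Y → a ∈ᵖ (X ∩ᵖ Y)
    ∩⁺ X Y = Equivalence.from T-∧

    ∩⁻ : ∀ (X Y : 𝒫 A) {a} → a ∈ᵖ (X ∩ᵖ Y) → a ∈ᵖ X × a ∈ᵖ Y
    ∩⁻ X Y = Equivalence.to T-∧

  ⟦_⟧ᵍ-mono : ∀ α {I X Y} → X ⊆ᵖ Y → ⟦ α ⟧ᵍ I X ⊆ᵖ ⟦ α ⟧ᵍ I Y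
  ⟦ game a ⟧ᵍ-mono     {I} X⊆Y = mono I a X⊆Y
  ⟦ x ≔ θ ⟧ᵍ-mono          X⊆Y = X⊆Y
  ⟦ x ′= θ & ψ ⟧ᵍ-mono     X⊆Y =
    ⟪⟫⁺ (Evolution x _ _ _) ∘
    (λ e → record { Evolution e ; end = X⊆Y (Evolution.end e) }) ∘
    ⟪⟫⁻ (Evolution x _ _ _)
  ⟦ test ψ ⟧ᵍ-mono {I} {X} {Y} X⊆Y ω∈ with ∩⁻ (⟦ ψ ⟧ᶠ I) X ω∈
  ... | ω∈ψ , ω∈X = ∩⁺ (⟦ ψ ⟧ᶠ I) Y (ω∈ψ , X⊆Y ω∈X)
  ⟦ α ⊔ β ⟧ᵍ-mono  {I} {X} {Y} X⊆Y =
    ∪⁺ (⟦ α ⟧ᵍ I Y) (⟦ β ⟧ᵍ I Y) ∘ ⊎-map (⟦ α ⟧ᵍ-mono X⊆Y) (⟦ β ⟧ᵍ-mono X⊆Y) ∘ ∪⁻ (⟦ α ⟧ᵍ I X) (⟦ β ⟧ᵍ I X)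
  ⟦ α ⨟ β ⟧ᵍ-mono          X⊆Y = ⟦ α ⟧ᵍ-mono (⟦ β ⟧ᵍ-mono X⊆Y)
  ⟦ α *ᵍ ⟧ᵍ-mono {I} {X} {Y} X⊆Y ω∈ = ⟪⟫⁺ (λ ω → ∀ Z → (Y ∪ᵖ ⟦ α ⟧ᵍ I Z) ⊆ᵖ Z → ω ∈ᵖ Z) λ Z closed →
    ⟪⟫⁻ (λ ω → ∀ Z → (X ∪ᵖ ⟦ α ⟧ᵍ I Z) ⊆ᵖ Z → ω ∈ᵖ Z) ω∈ Z
      (closed ∘ ∪⁺ Y (⟦ α ⟧ᵍ I Z) ∘ ⊎-map X⊆Y (λ p → p) ∘ ∪⁻ X (⟦ α ⟧ᵍ I Z))
  ⟦ α ᵈ ⟧ᵍ-mono {I} {X} {Y} X⊆Y =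
    ∁-anti {X = ⟦ α ⟧ᵍ I (∁ᵖ Y)} {⟦ α ⟧ᵍ I (∁ᵖ X)} (⟦ α ⟧ᵍ-mono (∁-anti {X = X} {Y} X⊆Y))

  record Coincide (S : Pred Symbol 0ℓ) (I J : Interpretation) : Set where
    field
      funs  : FunsCoincide S I J
      preds : ∀ {k} (p : PredSym k) → predˢ p ∈ S → predᴵ I p ≡ predᴵ J p
      games : ∀ a → gameˢ a ∈ S → gameᴵ I a ≡ gameᴵ J a

  open Coincide

  Coincide-⊆ : ∀ {S S′ : Pred Symbol 0ℓ} {I J} → (∀ {s} → s ∈ S′ → s ∈ S) → Coincide S I J → Coincide S′ I J
  Coincide-⊆ S′⊆S I≈J = record
    { funs  = λ f → funs I≈J f ∘ S′⊆S
    ; preds = λ p → preds I≈J p ∘ S′⊆S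
    ; games = λ a → games I≈J a ∘ S′⊆S
    }

  coincidenceᶠ : ∀ φ {I J} → Coincide (Σᶠ φ) I J → ⟦ φ ⟧ᶠ I ≡ ⟦ φ ⟧ᶠ J
  coincidenceᵍ : ∀ α {I J} → Coincide (Σᵍ α) I J → ⟦ α ⟧ᵍ I ≡ ⟦ α ⟧ᵍ J

  coincidenceᶠ (θ ⩾ η) I≈J = cong₂ (λ f g → ⟪ (λ ω → g ω ≤ f ω) ⟫)
    (ext λ ω → coincidenceᵗ θ (λ f → funs I≈J f ∘ inj₁) (λ _ _ → refl))
    (ext λ ω → coincidenceᵗ η (λ f → funs I≈J f ∘ inj₂) (λ _ _ → refl))
  coincidenceᶠ (pred p θs) I≈J = cong₂ (λ P f ω → P (f ω)) (preds I≈J p (inj₁ refl))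
    (ext λ ω → coincidenceᵗˢ θs (λ f → funs I≈J f ∘ inj₂) (λ _ _ → refl))
  coincidenceᶠ (neg φ)   I≈J = cong ∁ᵖ (coincidenceᶠ φ I≈J)
  coincidenceᶠ (φ ⩓ ψ)   I≈J = cong₂ _∩ᵖ_
    (coincidenceᶠ φ (Coincide-⊆ inj₁ I≈J)) (coincidenceᶠ ψ (Coincide-⊆ inj₂ I≈J))
  coincidenceᶠ (ex x φ)  I≈J = cong (λ X → ⟪ (λ ω → ∃[ r ] ω [ x ↦ r ] ∈ᵖ X) ⟫) (coincidenceᶠ φ I≈J)
  coincidenceᶠ (⟨ α ⟩ φ) I≈J = cong₂ (λ F X → F X)
    (coincidenceᵍ α (Coincide-⊆ inj₁ I≈J)) (coincidenceᶠ φ (Coincide-⊆ inj₂ I≈J))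

  coincidenceᵍ (game a) I≈J = games I≈J a refl
  coincidenceᵍ (x ≔ θ)  I≈J = cong (λ (f : State → ℝ) X ω → X (ω [ x ↦ f ω ]))
    (ext λ ω → coincidenceᵗ θ (funs I≈J) (λ _ _ → refl))
  coincidenceᵍ (x ′= θ & ψ) I≈J = cong₂ (λ F Q X → ⟪ Evolution x F Q X ⟫)
    (ext λ ω → coincidenceᵗ θ (λ f → funs I≈J f ∘ inj₁) (λ _ _ → refl))
    (coincidenceᶠ ψ (Coincide-⊆ inj₂ I≈J))
  coincidenceᵍ (test ψ) I≈J = cong _∩ᵖ_ (coincidenceᶠ ψ I≈J)
  coincidenceᵍ (α ⊔ β)  I≈J = cong₂ (λ F G X → F X ∪ᵖ G X)
    (coincidenceᵍ α (Coincide-⊆ inj₁ I≈J)) (coincidenceᵍ β (Coincide-⊆ inj₂ I≈J))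
  coincidenceᵍ (α ⨟ β)  I≈J = cong₂ (λ F G X → F (G X))
    (coincidenceᵍ α (Coincide-⊆ inj₁ I≈J)) (coincidenceᵍ β (Coincide-⊆ inj₂ I≈J))
  coincidenceᵍ (α *ᵍ)   I≈J =
    cong (λ F X → ⟪ (λ ω → ∀ Z → (X ∪ᵖ F Z) ⊆ᵖ Z → ω ∈ᵖ Z) ⟫) (coincidenceᵍ α I≈J)
  coincidenceᵍ (α ᵈ)    I≈J = cong (λ F X → ∁ᵖ (F (∁ᵖ X))) (coincidenceᵍ α I≈J)

  -- Agreement on these variables does not determine the truth value: a game symbol contributes none
  -- of them, though its interpretation may depend on any.
  varsᶠ : Formula → List 𝒱
  varsᵍ : Game → List 𝒱

  varsᶠ (θ ⩾ η)     = varsᵗ θ ++ varsᵗ η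
  varsᶠ (pred p θs) = varsᵗˢ θs
  varsᶠ (neg φ)     = varsᶠ φ
  varsᶠ (φ ⩓ ψ)     = varsᶠ φ ++ varsᶠ ψ
  varsᶠ (ex x φ)    = x ∷ varsᶠ φ
  varsᶠ (⟨ α ⟩ φ)   = varsᵍ α ++ varsᶠ φ

  varsᵍ (game a)     = []
  varsᵍ (x ≔ θ)      = x ∷ varsᵗ θ
  varsᵍ (x ′= θ & ψ) = x ∷ x ′ ∷ varsᵗ θ ++ varsᶠ ψ
  varsᵍ (test ψ)     = varsᶠ ψ
  varsᵍ (α ⊔ β)      = varsᵍ α ++ varsᵍ β
  varsᵍ (α ⨟ β)      = varsᵍ α ++ varsᵍ β
  varsᵍ (α *ᵍ)       = varsᵍ α
  varsᵍ (α ᵈ)        = varsᵍ α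

  -- Game symbols may depend on all, possibly infinitely many, variables at once.
  -- A permutation of the states that respects the variables xs is a symmetry of
  -- the semantics of every expression over xs, once the interpretation of the
  -- game symbols is conjugated by it.
  record Symmetry (xs : List 𝒱) : Set where
    field
      τ          : State → State
      involutive : ∀ s → τ (τ s) ≡ s
      fixes      : ∀ {x} → x ∈ˡ xs → ∀ s → τ s x ≡ s x
      commutes   : ∀ {x} → x ∈ˡ xs → ∀ s r → τ (s [ x ↦ r ]) ≡ τ s [ x ↦ r ]

  module Transport {xs} (sym-xs : Symmetry xs) where
    open Symmetry sym-xs

    conjugate : Interpretation → Interpretation
    conjugate I = record
      { funᴵ   = funᴵ I
      ; smooth = smooth I
      ; predᴵ  = predᴵ I
      ; gameᴵ  = λ a X → gameᴵ I a (X ∘ τ) ∘ τ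
      ; mono   = λ a X⊆Y → mono I a X⊆Y
      }

    ∘τ∘τ : ∀ {A : Set} (f : State → A) → f ∘ τ ∘ τ ≡ f
    ∘τ∘τ f = ext λ s → cong f (involutive s)

    transportᵗ : ∀ θ I s → (∀ {x} → x ∈ˡ varsᵗ θ → x ∈ˡ xs) → ⟦ θ ⟧ᵗ (conjugate I) s ≡ ⟦ θ ⟧ᵗ I (τ s)
    transportᵗ θ I s θ⊆xs = coincidenceᵗ θ (λ _ _ _ → refl) (λ x x∈θ → sym (fixes (θ⊆xs x∈θ) s))

    transportᵗˢ : ∀ {k} (θs : Vec Term k) I s → (∀ {x} → x ∈ˡ varsᵗˢ θs → x ∈ˡ xs) →
                  ⟦ θs ⟧ᵗˢ (conjugate I) s ≡ ⟦ θs ⟧ᵗˢ I (τ s)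
    transportᵗˢ θs I s θs⊆xs = coincidenceᵗˢ θs (λ _ _ _ → refl) (λ x x∈θs → sym (fixes (θs⊆xs x∈θs) s))

    -- `s` is an update of `s′` at `x`, and `τ` commutes with that update.
    τ-agree : ∀ {x s s′} → x ∈ˡ xs → Agree (∁ ｛ x ｝) s s′ → Agree (∁ ｛ x ｝) (τ s) (τ s′)
    τ-agree {x} {s} {s′} x∈xs s≈s′ y x≢y = trans
      (cong (λ s → τ s y) (ext λ z → decompose z (z ≟ᵛ x)))
      (trans (cong (λ s → s y) (commutes x∈xs s′ (s x))) (update-other (τ s′) (x≢y ∘ sym)))
      where
      decompose : ∀ z → Dec (z ≡ x) → s z ≡ (s′ [ x ↦ s x ]) z
      decompose z (yes refl) = sym (update-same s′ x)
      decompose z (no z≢x)   = trans (s≈s′ z (z≢x ∘ sym)) (sym (update-other s′ z≢x))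

    τ-agree₂ : ∀ {x y s s′} → x ∈ˡ xs → y ∈ˡ xs →
               Agree (∁ (｛ x ｝ ∪ ｛ y ｝)) s s′ → Agree (∁ (｛ x ｝ ∪ ｛ y ｝)) (τ s) (τ s′)
    τ-agree₂ {x} {y} {s} {s′} x∈xs y∈xs s≈s′ z z∉ = trans
      (τ-agree x∈xs s≈s″ z (z∉ ∘ inj₁))
      (τ-agree y∈xs (λ w y≢w → update-other s′ (y≢w ∘ sym)) z (z∉ ∘ inj₂))
      where
      s≈s″ : Agree (∁ ｛ x ｝) s (s′ [ y ↦ s y ])
      s≈s″ w x≢w with w ≟ᵛ y
      ... | yes refl = refl
      ... | no w≢y   = s≈s′ w [ x≢w , w≢y ∘ sym ]′

    -- `τ` is applied to the flow at every time. It fixes the coordinates `x` and `x ′`, so slope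
    -- and derivative are unchanged, and it preserves agreement elsewhere.
    transport-Evolution : ∀ {x F Q X s} → x ∈ˡ xs → x ′ ∈ˡ xs →
      Evolution x (F ∘ τ) (Q ∘ τ) X s → Evolution x F Q (X ∘ τ) (τ s)
    transport-Evolution {x} {F} {Q} {X} {s} x∈xs x′∈xs e = record
      { r      = r
      ; φ      = τ ∘ φ
      ; r≥0    = r≥0
      ; start  = τ-agree x′∈xs start
      ; end    = subst (_∈ᵖ X) (sym (involutive (φ r))) end
      ; slope  = λ ζ ζ∈ → trans (fixes x′∈xs (φ ζ)) (slope ζ ζ∈)
      ; domain = domain
      ; frame  = λ ζ ζ∈ → τ-agree₂ x∈xs x′∈xs (frame ζ ζ∈)
      ; solves = λ ζ ζ∈ 0<r → subst₂ (λ f l → HasDerivativeWithin Duration f ζ l)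
                   (ext λ t → sym (fixes x∈xs (φ t))) (sym (fixes x′∈xs (φ ζ))) (solves ζ ζ∈ 0<r)
      }
      where open Evolution e

    transportᶠ : ∀ φ I → (∀ {x} → x ∈ˡ varsᶠ φ → x ∈ˡ xs) → ⟦ φ ⟧ᶠ (conjugate I) ≡ ⟦ φ ⟧ᶠ I ∘ τ
    transportᵍ : ∀ α I → (∀ {x} → x ∈ˡ varsᵍ α → x ∈ˡ xs) → ∀ X → ⟦ α ⟧ᵍ (conjugate I) X ≡ ⟦ α ⟧ᵍ I (X ∘ τ) ∘ τ

    transportᶠ (θ ⩾ η) I ⊆xs = cong₂ (λ f g → ⟪ (λ ω → g ω ≤ f ω) ⟫)
      (ext λ s → transportᵗ θ I s (⊆xs ∘ ∈-++⁺ˡ)) (ext λ s → transportᵗ η I s (⊆xs ∘ ∈-++⁺ʳ (varsᵗ θ)))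
    transportᶠ (pred p θs) I ⊆xs = ext λ s → cong (predᴵ I p) (transportᵗˢ θs I s ⊆xs)
    transportᶠ (neg φ)   I ⊆xs = cong ∁ᵖ (transportᶠ φ I ⊆xs)
    transportᶠ (φ ⩓ ψ)   I ⊆xs = cong₂ _∩ᵖ_
      (transportᶠ φ I (⊆xs ∘ ∈-++⁺ˡ)) (transportᶠ ψ I (⊆xs ∘ ∈-++⁺ʳ (varsᶠ φ)))
    transportᶠ (ex x φ)  I ⊆xs = ext λ s → ⟪⟫-≡
      (λ s → ∃[ r ] s [ x ↦ r ] ∈ᵖ ⟦ φ ⟧ᶠ (conjugate I)) (λ s → ∃[ r ] s [ x ↦ r ] ∈ᵖ ⟦ φ ⟧ᶠ I)
      (λ { (r , p) → r , subst T (eq s r) p }) (λ { (r , p) → r , subst T (sym (eq s r)) p })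
      where
      eq : ∀ s r → ⟦ φ ⟧ᶠ (conjugate I) (s [ x ↦ r ]) ≡ ⟦ φ ⟧ᶠ I (τ s [ x ↦ r ])
      eq s r = trans (cong (λ X → X (s [ x ↦ r ])) (transportᶠ φ I (⊆xs ∘ there)))
        (cong (⟦ φ ⟧ᶠ I) (commutes (⊆xs (here refl)) s r))
    transportᶠ (⟨ α ⟩ φ) I ⊆xs = trans (transportᵍ α I (⊆xs ∘ ∈-++⁺ˡ) _)
      (cong (λ X → ⟦ α ⟧ᵍ I X ∘ τ) (trans (cong (_∘ τ) (transportᶠ φ I (⊆xs ∘ ∈-++⁺ʳ (varsᵍ α)))) (∘τ∘τ _)))

    transportᵍ (game a) I ⊆xs X = refl
    transportᵍ (x ≔ θ)  I ⊆xs X = ext λ s → cong X (trans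
      (cong (λ r → s [ x ↦ r ]) (transportᵗ θ I s (⊆xs ∘ there)))
      (trans (cong (λ s′ → s′ [ x ↦ ⟦ θ ⟧ᵗ I (τ s) ]) (sym (involutive s)))
        (sym (commutes (⊆xs (here refl)) (τ s) _))))
    transportᵍ (x ′= θ & ψ) I ⊆xs X = trans
      (cong₂ (λ F Q → ⟪ Evolution x F Q X ⟫)
        (ext λ s → transportᵗ θ I s (⊆xs ∘ there ∘ there ∘ ∈-++⁺ˡ))
        (transportᶠ ψ I (⊆xs ∘ there ∘ there ∘ ∈-++⁺ʳ (varsᵗ θ))))
      (ext λ s → ⟪⟫-≡ (Evolution x (F ∘ τ) (Q ∘ τ) X) (Evolution x F Q (X ∘ τ))
        (transport-Evolution x∈xs x′∈xs)
        -- The converse is the same transport for the conjugated data, since `τ` is its own inverse.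
        (λ e → subst₂ (Evolution x (F ∘ τ) (Q ∘ τ)) (∘τ∘τ X) (involutive s)
          (transport-Evolution {F = F ∘ τ} {Q ∘ τ} x∈xs x′∈xs
            (subst₂ (λ F Q → Evolution x F Q (X ∘ τ) (τ s)) (sym (∘τ∘τ F)) (sym (∘τ∘τ Q)) e))))
      where
      F = ⟦ θ ⟧ᵗ I
      Q = ⟦ ψ ⟧ᶠ I
      x∈xs = ⊆xs (here refl)
      x′∈xs = ⊆xs (there (here refl))
    transportᵍ (test ψ) I ⊆xs X = trans (cong (_∩ᵖ X) (transportᶠ ψ I ⊆xs))
      (cong ((⟦ ψ ⟧ᶠ I ∘ τ) ∩ᵖ_) (sym (∘τ∘τ X)))
    transportᵍ (α ⊔ β)  I ⊆xs X = cong₂ _∪ᵖ_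
      (transportᵍ α I (⊆xs ∘ ∈-++⁺ˡ) X) (transportᵍ β I (⊆xs ∘ ∈-++⁺ʳ (varsᵍ α)) X)
    transportᵍ (α ⨟ β)  I ⊆xs X = trans (transportᵍ α I (⊆xs ∘ ∈-++⁺ˡ) _)
      (cong (λ X → ⟦ α ⟧ᵍ I X ∘ τ) (trans (cong (_∘ τ) (transportᵍ β I (⊆xs ∘ ∈-++⁺ʳ (varsᵍ α)) X)) (∘τ∘τ _)))
    -- Composition with `τ` exchanges the pre-fixed points of the two operators, hence also their
    -- intersections.
    transportᵍ (α *ᵍ)   I ⊆xs X = ext λ s → ⟪⟫-≡
      (λ s → ∀ Z → (X ∪ᵖ ⟦ α ⟧ᵍ (conjugate I) Z) ⊆ᵖ Z → s ∈ᵖ Z)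
      (λ s → ∀ Z → ((X ∘ τ) ∪ᵖ ⟦ α ⟧ᵍ I Z) ⊆ᵖ Z → s ∈ᵖ Z)
      (λ least Z closed → least (Z ∘ τ) λ {a} → closed ∘ subst T (cong₂ _∨_
        (cong X (sym (involutive a)))
        (trans (cong (λ Y → Y a) (transportᵍ α I ⊆xs (Z ∘ τ))) (cong (λ Z → ⟦ α ⟧ᵍ I Z (τ a)) (∘τ∘τ Z)))))
      (λ least Z closed → subst (_∈ᵖ Z) (involutive s) (least (Z ∘ τ) λ {a} → closed ∘ subst T (cong (X (τ a) ∨_)
        (trans (cong (⟦ α ⟧ᵍ I (Z ∘ τ)) (sym (involutive a)))
          (cong (λ Y → Y (τ a)) (sym (transportᵍ α I ⊆xs Z)))))))
    transportᵍ (α ᵈ)    I ⊆xs X = cong ∁ᵖ (transportᵍ α I ⊆xs (∁ᵖ X))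

  overwrite-cong : ∀ xs {ω ω′ ν ν′} → (∀ {x} → x ∉ˡ xs → ω x ≡ ω′ x) → AgreeOn xs ν ν′ →
                   overwrite xs ω ν ≡ overwrite xs ω′ ν′
  overwrite-cong xs {ω} {ω′} {ν} {ν′} off on = ext λ x → go x (x ∈? xs)
    where
    go : ∀ x → Dec (x ∈ˡ xs) → overwrite xs ω ν x ≡ overwrite xs ω′ ν′ x
    go x (yes x∈xs) = trans (overwrite-∈ xs ω ν x∈xs) (trans (on x x∈xs) (sym (overwrite-∈ xs ω′ ν′ x∈xs)))
    go x (no x∉xs)  = trans (overwrite-∉ xs ω ν x∉xs) (trans (off x∉xs) (sym (overwrite-∉ xs ω′ ν′ x∉xs)))

  overwrite-id : ∀ xs {ω ν} → AgreeOn xs ω ν → overwrite xs ω ν ≡ ω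
  overwrite-id xs {ω} {ν} on = ext λ x → go x (x ∈? xs)
    where
    go : ∀ x → Dec (x ∈ˡ xs) → overwrite xs ω ν x ≡ ω x
    go x (yes x∈xs) = trans (overwrite-∈ xs ω ν x∈xs) (sym (on x x∈xs))
    go x (no x∉xs)  = overwrite-∉ xs ω ν x∉xs

  -- Make t commute with updates of xs: apply it to the state whose values on xs
  -- are reset to those of the base state, then restore the values on xs.
  module Conjugation (xs : List 𝒱) (base : State) (t : State → State)
                     (t-involutive : ∀ s → t (t s) ≡ s) (t-fixes : ∀ s → AgreeOn xs (t s) s) where

    reset : State → State
    reset s = overwrite xs s base

    τ : State → State
    τ s = overwrite xs (t (reset s)) s

    -- `reset` carries `τ` to `t`, which lets `τ` inherit involutivity from `t`.
    reset-τ : ∀ s → reset (τ s) ≡ t (reset s)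
    reset-τ s = trans
      (overwrite-cong xs (overwrite-∉ xs _ s) λ x x∈xs →
        sym (trans (t-fixes (reset s) x x∈xs) (overwrite-∈ xs s base x∈xs)))
      (overwrite-id xs {ν = t (reset s)} (λ _ _ → refl))

    symmetry : Symmetry xs
    symmetry = record
      { τ          = τ
      ; involutive = λ s → trans
          (overwrite-cong xs {ν′ = s} (λ {x} x∉xs → trans
              (cong (λ u → u x) (trans (cong t (reset-τ s)) (t-involutive (reset s))))
              (overwrite-∉ xs s base x∉xs))
            (λ x x∈xs → overwrite-∈ xs _ s x∈xs))
          (overwrite-id xs {ν = s} (λ _ _ → refl))
      ; fixes      = λ x∈xs s → overwrite-∈ xs _ s x∈xs
      ; commutes   = λ x∈xs s r → ext λ y → commutes x∈xs s r y (y ∈? xs)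
      }
      where
      commutes : ∀ {x} → x ∈ˡ xs → ∀ s r y → Dec (y ∈ˡ xs) → τ (s [ x ↦ r ]) y ≡ (τ s [ x ↦ r ]) y
      commutes {x} x∈xs s r y (yes y∈xs) = trans (overwrite-∈ xs _ (s [ x ↦ r ]) y∈xs)
        (update-cong x (λ _ → sym (overwrite-∈ xs _ s y∈xs)))
      commutes {x} x∈xs s r y (no y∉xs) = trans (overwrite-∉ xs _ (s [ x ↦ r ]) y∉xs) (trans
        (cong (λ u → t u y) (overwrite-cong xs
          (λ z∉xs → update-other s (λ { refl → z∉xs x∈xs })) (λ _ _ → refl)))
        (sym (trans (update-other (τ s) (λ { refl → y∉xs x∈xs })) (overwrite-∉ xs _ s y∉xs))))

    -- On the states that have the base values on `xs`, nothing is reset, so here the freely chosen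
    -- `t` can be read off from `τ`.
    τ≡t : ∀ s → AgreeOn xs s base → τ s ≡ t s
    τ≡t s s≈base = trans (cong (λ u → overwrite xs (t u) s) (overwrite-id xs s≈base))
      (overwrite-id xs (t-fixes s))

  module Transposition (a b : State) where

    swap : State → State
    swap s with em {s ≡ a} | em {s ≡ b}
    ... | yes _ | _     = b
    ... | no _  | yes _ = a
    ... | no _  | no _  = s

    swap-a : swap a ≡ b
    swap-a with em {a ≡ a}
    ... | yes _  = refl
    ... | no a≢a = contradiction refl a≢a

    swap-b : swap b ≡ a
    swap-b with em {b ≡ a} | em {b ≡ b}
    ... | yes b≡a | _      = b≡a
    ... | no _    | yes _  = refl
    ... | no _    | no b≢b = contradiction refl b≢b

    swap-other : ∀ {s} → s ≢ a → s ≢ b → swap s ≡ s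
    swap-other {s} s≢a s≢b with em {s ≡ a} | em {s ≡ b}
    ... | yes s≡a | _       = contradiction s≡a s≢a
    ... | no _    | yes s≡b = contradiction s≡b s≢b
    ... | no _    | no _    = refl

    swap-involutive : ∀ s → swap (swap s) ≡ s
    swap-involutive s with em {s ≡ a} | em {s ≡ b}
    ... | yes refl | _        = swap-b
    ... | no _     | yes refl = swap-a
    ... | no s≢a   | no s≢b   = swap-other s≢a s≢b

    swap-fixes : ∀ {xs} → AgreeOn xs a b → ∀ s → AgreeOn xs (swap s) s
    swap-fixes a≈b s x x∈ with em {s ≡ a} | em {s ≡ b}
    ... | yes refl | _        = sym (a≈b x x∈)
    ... | no _     | yes refl = a≈b x x∈
    ... | no _     | no _     = refl

  -- Formulas without free variables.

  ∉FVᶠ⇒invariant : ∀ φ {x} → x ∉ FVᶠ φ → ∀ I s r → ⟦ φ ⟧ᶠ I (s [ x ↦ r ]) ≡ ⟦ φ ⟧ᶠ I s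
  ∉FVᶠ⇒invariant φ {x} x∉FV I s r = T-ext
    (λ s′∈ → decidable-stable (T? _) λ s∉ → x∉FV
      (I , s [ x ↦ r ] , s , (λ y x≢y → update-other s (x≢y ∘ sym)) , s′∈ , s∉))
    (λ s∈ → decidable-stable (T? _) λ s′∉ → x∉FV
      (I , s , s [ x ↦ r ] , (λ y x≢y → sym (update-other s (x≢y ∘ sym))) , s∈ , s′∉))

  -- Finitely many variables are changed one at a time.  States that agree on the
  -- variables of φ differ, up to a symmetry of the semantics, in one variable.
  FVᶠ-empty : ∀ φ → Empty (FVᶠ φ) → ∀ I ω ν → ⟦ φ ⟧ᶠ I ω ≡ ⟦ φ ⟧ᶠ I ν
  FVᶠ-empty φ FV≡∅ I ω ν = trans
    (sym (overwrite-invariant (⟦ φ ⟧ᶠ I) {∅} (λ x _ s r → ∉FVᶠ⇒invariant φ (FV≡∅ x) I s r) xs (λ _ ())))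
    ω′~ν
    where
    xs = varsᶠ φ

    ω′ : State
    ω′ = overwrite xs ω ν

    ω′≈ν : AgreeOn xs ω′ ν
    ω′≈ν x = overwrite-∈ xs ω ν

    tail : ∀ y → ω′ y ≢ ν y → ⟦ φ ⟧ᶠ I ω′ ≡ ⟦ φ ⟧ᶠ I ν
    tail y ω′y≢νy = begin
      ⟦ φ ⟧ᶠ I ω′                 ≡⟨ cong (⟦ φ ⟧ᶠ I) (sym τω′≡ω′) ⟩
      ⟦ φ ⟧ᶠ I (τ ω′)             ≡⟨ cong (λ X → X ω′) (sym (transportᶠ φ I (λ x∈ → x∈))) ⟩
      ⟦ φ ⟧ᶠ (conjugate I) ω′     ≡⟨ sym (∉FVᶠ⇒invariant φ (FV≡∅ y) (conjugate I) ω′ (ν y)) ⟩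
      ⟦ φ ⟧ᶠ (conjugate I) κ      ≡⟨ cong (λ X → X κ) (transportᶠ φ I (λ x∈ → x∈)) ⟩
      ⟦ φ ⟧ᶠ I (τ κ)              ≡⟨ cong (⟦ φ ⟧ᶠ I) τκ≡ν ⟩
      ⟦ φ ⟧ᶠ I ν                  ∎
      where
      open ≡-Reasoning

      -- One update away from `ω′`, hence indistinguishable from it in every interpretation, the
      -- conjugate one included. Transposing `κ` with `ν` turns this into the same claim about `ν`
      -- in `I`. As `ω′` and `ν` agree on `xs`, `y` is outside `xs`, and the transposition respects
      -- `xs`.
      κ : State
      κ = ω′ [ y ↦ ν y ]

      κ≈ω′ : AgreeOn xs κ ω′
      κ≈ω′ x x∈xs = update-other ω′ λ { refl → ω′y≢νy (ω′≈ν x x∈xs) }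

      open Transposition ν κ
      open Conjugation xs ω′ swap swap-involutive
        (swap-fixes (λ x x∈xs → trans (sym (ω′≈ν x x∈xs)) (sym (κ≈ω′ x x∈xs)))) using (τ; τ≡t; symmetry)
      open Transport symmetry using (conjugate; transportᶠ)

      -- Both transposed states have the value `ν y` at `y`, and `ω′` does not.
      τω′≡ω′ : τ ω′ ≡ ω′
      τω′≡ω′ = trans (τ≡t ω′ (λ _ _ → refl)) (swap-other
        (λ ω′≡ν → ω′y≢νy (cong (λ s → s y) ω′≡ν))
        (λ ω′≡κ → ω′y≢νy (trans (cong (λ s → s y) ω′≡κ) (update-same ω′ y))))

      τκ≡ν : τ κ ≡ ν
      τκ≡ν = trans (τ≡t κ κ≈ω′) swap-b

    ω′~ν : ⟦ φ ⟧ᶠ I ω′ ≡ ⟦ φ ⟧ᶠ I ν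
    ω′~ν with em {∃[ y ] ω′ y ≢ ν y}
    ... | yes (y , ω′y≢νy) = tail y ω′y≢νy
    ... | no ω′≈ν = cong (⟦ φ ⟧ᶠ I) (ext λ y → decidable-stable em λ ω′y≢νy → ω′≈ν (y , ω′y≢νy))

  -- The bound effect of games.

  ↓⁺ : ∀ {X ω V ν} → ν ∈ᵖ X → Agree V ν ω → ν ∈ᵖ (X ↓ ω ⟨ V ⟩)
  ↓⁺ {X} {ω} {V} ν∈X ν≈ω = ⟪⟫⁺ (λ ν → ν ∈ᵖ X × Agree V ν ω) (ν∈X , ν≈ω)

  ↓⁻ : ∀ {X ω V ν} → ν ∈ᵖ (X ↓ ω ⟨ V ⟩) → ν ∈ᵖ X × Agree V ν ω
  ↓⁻ {X} {ω} {V} = ⟪⟫⁻ (λ ν → ν ∈ᵖ X × Agree V ν ω)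

  ∉BV⇒↓ : ∀ α {x} → x ∉ BV α → ∀ I {ω X} → ω ∈ᵖ ⟦ α ⟧ᵍ I X → ω ∈ᵖ ⟦ α ⟧ᵍ I (X ↓ ω ⟨ ｛ x ｝ ⟩)
  ∉BV⇒↓ α x∉BV I {ω} {X} ω∈ = decidable-stable (T? _) λ ω∉ → x∉BV (I , ω , X , ω∈ , ω∉)

  module BoundEffect (α : Game) (I : Interpretation) (ω : State) where

    xs = varsᵍ α

    -- The restriction to one unbound variable is available for every target set, so it can be
    -- applied again to a set that is already restricted.
    finite : ∀ zs {X} → ω ∈ᵖ ⟦ α ⟧ᵍ I X → ω ∈ᵖ ⟦ α ⟧ᵍ I (X ↓ ω ⟨ (λ x → x ∈ˡ zs × x ∉ BV α) ⟩)
    finite []       {X} ω∈ = ⟦ α ⟧ᵍ-mono (λ ν∈X → ↓⁺ {X} ν∈X (λ _ ())) ω∈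
    finite (z ∷ zs) {X} ω∈ with em {z ∈ BV α}
    ... | yes z∈BV = ⟦ α ⟧ᵍ-mono
      (λ ν∈ → let ν∈X , ν≈ω = ↓⁻ {X} ν∈ in ↓⁺ {X} ν∈X λ
        { x (here refl , x∉BV) → contradiction z∈BV x∉BV ; x (there x∈zs , x∉BV) → ν≈ω x (x∈zs , x∉BV) })
      (finite zs ω∈)
    ... | no z∉BV = ⟦ α ⟧ᵍ-mono
      (λ ν∈ → let ν∈Y , νz≡ωz = ↓⁻ {Y} ν∈ ; ν∈X , ν≈ω = ↓⁻ {X} ν∈Y in ↓⁺ {X} ν∈X λ
        { x (here refl , _) → νz≡ωz x refl ; x (there x∈zs , x∉BV) → ν≈ω x (x∈zs , x∉BV) })
      (∉BV⇒↓ α z∉BV I (finite zs ω∈))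
      where
      Y = X ↓ ω ⟨ (λ x → x ∈ˡ zs × x ∉ BV α) ⟩

    -- If some y outside xs is not bound, then no variable outside xs changes: the
    -- states with the value ω(y) of y and their images under a symmetry have only
    -- ω in common outside xs.
    module _ {y} (y∉xs : y ∉ˡ xs) (y∉BV : y ∉ BV α) where

      -- The reflection sending `r` to `c - r` is an involution that takes `ω y` to `ω y + 1#`, so
      -- it moves every state with the value `ω y` at `y`.
      c : ℝ
      c = ω y + (ω y + 1#)

      flip : State → State
      flip s = s [ y ↦ c - s y ]

      flip-y : ∀ s → s y ≡ ω y → flip s y ≢ ω y
      flip-y s sy≡ωy eq = 0≢1 (sym (begin
        1#                            ≡⟨ solve 2 (λ w o → o := (w :+ (w :+ o)) :- w :- w) refl (ω y) 1# ⟩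
        c - ω y - ω y                 ≡⟨ cong (λ r → c - r - ω y) (sym sy≡ωy) ⟩
        c - s y - ω y                 ≡⟨ cong (_- ω y) (trans (sym (update-same s y)) eq) ⟩
        ω y - ω y                     ≡⟨ -‿inverseʳ (ω y) ⟩
        0#                            ∎))
        where open ≡-Reasoning

      flip-involutive : ∀ s → flip (flip s) ≡ s
      flip-involutive s = ext λ z → go z (z ≟ᵛ y)
        where
        go : ∀ z → Dec (z ≡ y) → flip (flip s) z ≡ s z
        go z (yes refl) = trans (update-same (flip s) y) (trans (cong (λ r → c - r) (update-same s y))
          (solve 2 (λ c w → c :- (c :- w) := w) refl c (s y)))
        go z (no z≢y)   = trans (update-other (flip s) z≢y) (update-other s z≢y)

      -- `ω` must stay fixed for membership of `ω` to be transported; its partner under `flip` must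
      -- then be fixed too, or `t` would not be an involution.
      Exceptional : State → Set
      Exceptional s = s ≡ ω ⊎ s ≡ flip ω

      t : State → State
      t s with em {Exceptional s}
      ... | yes _ = s
      ... | no _  = flip s

      t-exceptional : ∀ {s} → Exceptional s → t s ≡ s
      t-exceptional {s} e with em {Exceptional s}
      ... | yes _ = refl
      ... | no ¬e = contradiction e ¬e

      t-flip : ∀ {s} → ¬ Exceptional s → t s ≡ flip s
      t-flip {s} ¬e with em {Exceptional s}
      ... | yes e = contradiction e ¬e
      ... | no _  = refl

      flip-exceptional : ∀ {s} → Exceptional (flip s) → Exceptional s
      flip-exceptional {s} (inj₁ eq) = inj₂ (trans (sym (flip-involutive s)) (cong flip eq))
      flip-exceptional {s} (inj₂ eq) = inj₁
        (trans (sym (flip-involutive s)) (trans (cong flip eq) (flip-involutive ω)))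

      t-involutive : ∀ s → t (t s) ≡ s
      t-involutive s with em {Exceptional s}
      ... | yes e = t-exceptional e
      ... | no ¬e = trans (t-flip (¬e ∘ flip-exceptional)) (flip-involutive s)

      t-fixes : ∀ s → AgreeOn xs (t s) s
      t-fixes s x x∈xs with em {Exceptional s}
      ... | yes _ = refl
      ... | no _  = update-other s λ { refl → y∉xs x∈xs }

      open Conjugation xs ω t t-involutive t-fixes
      open Transport symmetry using (conjugate; transportᵍ; ∘τ∘τ)

      τω≡ω : τ ω ≡ ω
      τω≡ω = trans (τ≡t ω (λ _ _ → refl)) (t-exceptional (inj₁ refl))

      -- If `reset ν` were flipped, `τ ν` would have a value other than `ω y` at `y`; so `reset ν`
      -- is exceptional, and its value at `y` rules out `flip ω`.
      separate : ∀ ν → ν y ≡ ω y → τ ν y ≡ ω y → Agree (_∉ˡ xs) ν ω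
      separate ν νy≡ωy τνy≡ωy x x∉xs = go em
        where
        go : Dec (Exceptional (reset ν)) → ν x ≡ ω x
        go (yes (inj₁ eq)) = trans (sym (overwrite-∉ xs ν ω x∉xs)) (cong (λ s → s x) eq)
        go (yes (inj₂ eq)) = contradiction
          (trans (sym (cong (λ s → s y) eq)) (trans (overwrite-∉ xs ν ω y∉xs) νy≡ωy)) (flip-y ω refl)
        go (no ¬e)         = contradiction
          (trans (sym (trans (overwrite-∉ xs _ ν y∉xs) (cong (λ s → s y) (t-flip ¬e)))) τνy≡ωy)
          (flip-y (reset ν) (trans (overwrite-∉ xs ν ω y∉xs) νy≡ωy))

      -- That `y` is unbound is used twice, in `I` and in the conjugate interpretation: the first
      -- use fixes `ν y`, the second `τ ν y`.
      tail : ∀ {X} → ω ∈ᵖ ⟦ α ⟧ᵍ I X → ω ∈ᵖ ⟦ α ⟧ᵍ I (X ↓ ω ⟨ _∉ˡ xs ⟩)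
      tail {X} ω∈ = ⟦ α ⟧ᵍ-mono
        (λ {ν} ν∈ →
          let τν∈ , τνy = ↓⁻ {X₁ ∘ τ} ν∈
              ν∈X , νy = ↓⁻ {X} (subst (_∈ᵖ X₁) (Symmetry.involutive symmetry ν) τν∈)
          in ↓⁺ {X} ν∈X (separate ν (νy y refl) (τνy y refl)))
        (subst T (trans (cong (λ Y → Y ω) (transportᵍ α I (λ x∈ → x∈) X₂)) (cong (⟦ α ⟧ᵍ I (X₂ ∘ τ)) τω≡ω))
          (∉BV⇒↓ α y∉BV (conjugate I)
            (subst T (sym (trans (cong (λ Y → Y ω) (transportᵍ α I (λ x∈ → x∈) (X₁ ∘ τ)))
                (cong₂ (⟦ α ⟧ᵍ I) (∘τ∘τ X₁) τω≡ω)))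
              (∉BV⇒↓ α y∉BV I ω∈))))
        where
        X₁ X₂ : 𝒫 State
        X₁ = X ↓ ω ⟨ ｛ y ｝ ⟩
        X₂ = (X₁ ∘ τ) ↓ ω ⟨ ｛ y ｝ ⟩

    bound-effect : ∀ {X} → ω ∈ᵖ ⟦ α ⟧ᵍ I X → ω ∈ᵖ ⟦ α ⟧ᵍ I (X ↓ ω ⟨ ∁ (BV α) ⟩)
    bound-effect {X} ω∈ with em {∃[ y ] y ∉ˡ xs × y ∉ BV α}
    ... | yes (y , y∉xs , y∉BV) = ⟦ α ⟧ᵍ-mono
      (λ ν∈ → let ν∈Y , on = ↓⁻ {Y} ν∈ ; ν∈X , off = ↓⁻ {X} ν∈Y in ↓⁺ {X} ν∈X λ x x∉BV →
        combine x (on x) (off x) x∉BV (x ∈? xs))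
      (finite xs (tail y∉xs y∉BV ω∈))
      where
      Y = X ↓ ω ⟨ _∉ˡ xs ⟩
      combine : ∀ x {P : Set} → (x ∈ˡ xs × x ∉ BV α → P) → (x ∉ˡ xs → P) → x ∉ BV α → Dec (x ∈ˡ xs) → P
      combine x on off x∉BV (yes x∈xs) = on (x∈xs , x∉BV)
      combine x on off x∉BV (no x∉xs)  = off x∉xs
    -- Now every unbound variable lies in `xs`, and the finite restriction is the whole claim.
    ... | no all-bound = ⟦ α ⟧ᵍ-mono
      (λ ν∈ → let ν∈X , on = ↓⁻ {X} ν∈ in ↓⁺ {X} ν∈X λ x x∉BV →
        on x (decidable-stable (x ∈? xs) (λ x∉xs → all-bound (x , x∉xs , x∉BV)) , x∉BV))
      (finite xs ω∈)

-- Substitution for the dots, compared state by state.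

module Substitution (ℛ : Reals) (em : ExcludedMiddle 0ℓ) (ext : Extensionality 0ℓ 0ℓ) (ℒ : Language) where
  open dGL ℛ em ℒ
  open TermSemantics ℛ em ext ℒ
  open GameSemantics ℛ em ext ℒ

  -- A dot beyond the arguments keeps its value in `I`, just as `dots↦` leaves it in place.
  _[·↦_] : ∀ {k} → Interpretation → Vec ℝ k → Interpretation
  I [·↦ d ] = I [·≔ (λ i → fromMaybe (funᴵ I (dot i) []) (d !? i)) ]

  ⟦⟧ᵗˢ-!? : ∀ {k} (θs : Vec Term k) {I ω} i → ⟦ θs ⟧ᵗˢ I ω !? i ≡ Maybe.map (λ θ → ⟦ θ ⟧ᵗ I ω) (θs !? i)
  ⟦⟧ᵗˢ-!? []       i       = refl
  ⟦⟧ᵗˢ-!? (θ ∷ θs) zero    = refl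
  ⟦⟧ᵗˢ-!? (θ ∷ θs) (suc i) = ⟦⟧ᵗˢ-!? θs i

  [·↦[]]-coincide : ∀ {S I} → Coincide S (I [·↦ [] ]) I
  [·↦[]]-coincide = record
    { funs  = λ { (fun f) _ v → refl ; (dot i) _ [] → refl }
    ; preds = λ _ _ → refl
    ; games = λ _ _ → refl
    }

  ↾-fun⁺ : ∀ σ {S k} {f : FunSym k} → funˢ f ∈ S → fun⁺ (σ ↾ S) f ≡ fun⁺ σ f
  ↾-fun⁺ σ {S} {f = f} f∈S with em {funˢ f ∈ S}
  ... | yes _   = refl
  ... | no f∉S  = contradiction f∈S f∉S

  -- A dot in `S` stands for an argument whose free variables avoid `V`, so its value is the same in
  -- two states that differ only on `V`.
  admissible⇒coincide : ∀ {k} (θs : Vec Term k) {V S I ω ν} → dots↦ θs isAdmissible[ V ]For S →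
                        Agree (∁ V) ω ν → Coincide S (I [·↦ ⟦ θs ⟧ᵗˢ I ω ]) (I [·↦ ⟦ θs ⟧ᵗˢ I ν ])
  admissible⇒coincide θs {V} {S} {I} {ω} {ν} adm ω≈ν = record
    { funs  = λ { (fun f) _ v → refl ; (dot i) dot∈S v → cong (fromMaybe _)
        (trans (⟦⟧ᵗˢ-!? θs i) (trans (argument i dot∈S (θs !? i) refl) (sym (⟦⟧ᵗˢ-!? θs i)))) }
    ; preds = λ _ _ → refl
    ; games = λ _ _ → refl
    }
    where
    argument : ∀ i → funˢ (dot i) ∈ S → ∀ m → θs !? i ≡ m →
               Maybe.map (λ θ → ⟦ θ ⟧ᵗ I ω) m ≡ Maybe.map (λ θ → ⟦ θ ⟧ᵗ I ν) m
    argument i dot∈S nothing  _  = refl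
    argument i dot∈S (just θ) eq = cong just (FVᵗ-coincidence θ λ x x∈FV → ω≈ν x λ x∈V →
      adm x (inj₁ (0 , dot i , θ , trans (↾-fun⁺ (dots↦ θs) dot∈S) eq , x∈FV) , x∈V))

  dots-substᵗ  : ∀ {k} {θs : Vec Term k} {θ θ′} → dots↦ θs ⊢ θ ↦ᵗ θ′ → ∀ I ω →
                 ⟦ θ′ ⟧ᵗ I ω ≡ ⟦ θ ⟧ᵗ (I [·↦ ⟦ θs ⟧ᵗˢ I ω ]) ω
  dots-substᵗˢ : ∀ {k} {θs : Vec Term k} {m} {ηs ηs′ : Vec Term m} → dots↦ θs ⊢ ηs ↦ᵗˢ ηs′ → ∀ I ω →
                 ⟦ ηs′ ⟧ᵗˢ I ω ≡ ⟦ ηs ⟧ᵗˢ (I [·↦ ⟦ θs ⟧ᵗˢ I ω ]) ω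

  dots-substᵗ var I ω = refl
  dots-substᵗ (keep {f = fun f} _ d) I ω = cong (funᴵ I (fun f)) (dots-substᵗˢ d I ω)
  dots-substᵗ {θs = θs} (keep {f = dot i} {θs = []} {[]} eq d) I ω =
    sym (cong (fromMaybe _) (trans (⟦⟧ᵗˢ-!? θs i) (cong (Maybe.map _) eq)))
  -- A dot is nullary, so the inner substitution is `dots↦ []`, whose interpretation gives every
  -- symbol its meaning in `I`.
  dots-substᵗ {θs = θs} (repl {f = dot i} {θs = []} {[]} {σf} eq d e) I ω = trans
    (dots-substᵗ e I ω)
    (trans (coincidenceᵗ σf (Coincide.funs ([·↦[]]-coincide {Σᵗ σf})) (λ _ _ → refl))
      (sym (cong (fromMaybe _) (trans (⟦⟧ᵗˢ-!? θs i) (cong (Maybe.map _) eq)))))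
  dots-substᵗ (d ⊕ e) I ω = cong₂ _+_ (dots-substᵗ d I ω) (dots-substᵗ e I ω)
  dots-substᵗ (d ⊙ e) I ω = cong₂ _*_ (dots-substᵗ d I ω) (dots-substᵗ e I ω)
  -- A derivative involves other states `ν`, while the dots are frozen at `ω`; `U`-admissibility
  -- makes their values the same in all states.
  dots-substᵗ {θs = θs} (D {θ = θ} adm d) I ω = cong (λ F → ∑𝒱 λ x → ω (x ′) * ∂ F x ω)
    (ext λ ν → trans (dots-substᵗ d I ν)
      (coincidenceᵗ θ
        (Coincide.funs (admissible⇒coincide θs {U} {I = I} adm λ x x∉U → contradiction _ x∉U)) (λ _ _ → refl)))

  dots-substᵗˢ []      I ω = refl
  dots-substᵗˢ (d ∷ e) I ω = cong₂ _∷_ (dots-substᵗ d I ω) (dots-substᵗˢ e I ω)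

  -- A flow from `ω` changes only `x` and `x ′`, so it never meets a state where the data may
  -- differ.
  Evolution-cong : ∀ {x F F′ Q Q′ X ω} →
    (∀ s → Agree (∁ (｛ x ｝ ∪ ｛ x ′ ｝)) s ω → F s ≡ F′ s) →
    (∀ s → Agree (∁ (｛ x ｝ ∪ ｛ x ′ ｝)) s ω → Q s ≡ Q′ s) →
    Evolution x F Q X ω → Evolution x F′ Q′ X ω
  Evolution-cong {x} {ω = ω} F≗F′ Q≗Q′ e = record
    { Evolution e
    ; slope  = λ ζ ζ∈ → trans (slope ζ ζ∈) (F≗F′ (φ ζ) (reachable ζ ζ∈))
    ; domain = λ ζ ζ∈ → subst T (Q≗Q′ (φ ζ) (reachable ζ ζ∈)) (domain ζ ζ∈)
    }
    where
    open Evolution e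
    reachable : ∀ ζ → ζ ∈ Duration → Agree (∁ (｛ x ｝ ∪ ｛ x ′ ｝)) (φ ζ) ω
    reachable ζ ζ∈ y y∉ = trans (frame ζ ζ∈ y y∉) (start y (y∉ ∘ inj₂))

  ⟦_⟧ᵍ-local : ∀ α {I ω X Y} → (∀ {ν} → Agree (∁ (BV α)) ω ν → ν ∈ᵖ X → ν ∈ᵖ Y) →
               ω ∈ᵖ ⟦ α ⟧ᵍ I X → ω ∈ᵖ ⟦ α ⟧ᵍ I Y
  ⟦ α ⟧ᵍ-local {I} {ω} {X} X⊆Y ω∈ = ⟦ α ⟧ᵍ-mono
    (λ ν∈ → let ν∈X , ν≈ω = ↓⁻ {X} ν∈ in X⊆Y (λ x x∉BV → sym (ν≈ω x x∉BV)) ν∈X)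
    (BoundEffect.bound-effect α I ω ω∈)

  ⟦_⟧ᵍ-local-≡ : ∀ α {I ω X Y} → (∀ ν → Agree (∁ (BV α)) ω ν → X ν ≡ Y ν) → ⟦ α ⟧ᵍ I X ω ≡ ⟦ α ⟧ᵍ I Y ω
  ⟦ α ⟧ᵍ-local-≡ {X = X} {Y} X≗Y = T-ext
    (⟦ α ⟧ᵍ-local {X = X} {Y} λ ω≈ν → subst T (X≗Y _ ω≈ν))
    (⟦ α ⟧ᵍ-local {X = Y} {X} λ ω≈ν → subst T (sym (X≗Y _ ω≈ν)))

  Loop : (𝒫 State → 𝒫 State) → 𝒫 State → Pred State 0ℓ
  Loop F X ω = ∀ Z → (X ∪ᵖ F Z) ⊆ᵖ Z → ω ∈ᵖ Z

  -- A set closed under F near ω is extended by all states that differ from ω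
  -- outside V; G, which cannot leave this neighbourhood of ω, keeps it closed.
  Loop-local : ∀ V {F G : 𝒫 State → 𝒫 State} {X ω} →
    (∀ ν → Agree V ω ν → ∀ Z → F Z ν ≡ G Z ν) →
    (∀ {ν Y Z} → Agree V ω ν → (∀ {μ} → Agree V ω μ → μ ∈ᵖ Y → μ ∈ᵖ Z) → ν ∈ᵖ F Y → ν ∈ᵖ F Z) →
    Loop F X ω → Loop G X ω
  Loop-local V {F} {G} {X} {ω} F≗G local least Z closed =
    ⟪⟫⁻ Z′ (least ⟪ Z′ ⟫ (⟪⟫⁺ Z′ ∘ λ ν∈ ω≈ν →
      closed (∪⁺ X (G Z) (⊎-map (λ p → p)
        (subst T (F≗G _ ω≈ν Z) ∘ local ω≈ν (λ ω≈μ μ∈Z′ → ⟪⟫⁻ Z′ μ∈Z′ ω≈μ)) (∪⁻ X (F ⟪ Z′ ⟫) ν∈))))) (λ _ _ → refl)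
    where
    Z′ : Pred State 0ℓ
    Z′ ν = Agree V ω ν → ν ∈ᵖ Z

  dots-substᶠ : ∀ {k} {θs : Vec Term k} {φ φ′} → dots↦ θs ⊢ φ ↦ᶠ φ′ → ∀ I ω →
                ⟦ φ′ ⟧ᶠ I ω ≡ ⟦ φ ⟧ᶠ (I [·↦ ⟦ θs ⟧ᵗˢ I ω ]) ω
  dots-substᵍ : ∀ {k} {θs : Vec Term k} {α α′} → dots↦ θs ⊢ α ↦ᵍ α′ → ∀ I ω X →
                ⟦ α′ ⟧ᵍ I X ω ≡ ⟦ α ⟧ᵍ (I [·↦ ⟦ θs ⟧ᵗˢ I ω ]) X ω

  -- The form needed below a binder: evaluation takes place at `ν`, but the arguments stay frozen at
  -- the outer state `ω`.
  dots-subst-nearᶠ : ∀ {k} {θs : Vec Term k} {V φ φ′} → dots↦ θs isAdmissible[ V ]For Σᶠ φ →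
    dots↦ θs ⊢ φ ↦ᶠ φ′ → ∀ I {ω} ν → Agree (∁ V) ν ω → ⟦ φ′ ⟧ᶠ I ν ≡ ⟦ φ ⟧ᶠ (I [·↦ ⟦ θs ⟧ᵗˢ I ω ]) ν
  dots-subst-nearᵍ : ∀ {k} {θs : Vec Term k} {V α α′} → dots↦ θs isAdmissible[ V ]For Σᵍ α →
    dots↦ θs ⊢ α ↦ᵍ α′ → ∀ I {ω} ν → Agree (∁ V) ν ω → ∀ X → ⟦ α′ ⟧ᵍ I X ν ≡ ⟦ α ⟧ᵍ (I [·↦ ⟦ θs ⟧ᵗˢ I ω ]) X ν

  dots-subst-nearᶠ {θs = θs} {φ = φ} adm d I ν ν≈ω = trans (dots-substᶠ d I ν)
    (cong (λ X → X ν) (coincidenceᶠ φ (admissible⇒coincide θs adm ν≈ω)))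

  dots-subst-nearᵍ {θs = θs} {α = α} adm d I ν ν≈ω X = trans (dots-substᵍ d I ν X)
    (cong (λ F → F X ν) (coincidenceᵍ α (admissible⇒coincide θs adm ν≈ω)))

  dots-substᶠ {θs = θs} (_⩾_ {θ} {θ′} {η} {η′} d e) I ω = ⟪⟫-≡
    (λ ω → ⟦ η′ ⟧ᵗ I ω ≤ ⟦ θ′ ⟧ᵗ I ω) (λ ω → ⟦ η ⟧ᵗ J ω ≤ ⟦ θ ⟧ᵗ J ω)
    (subst₂ _≤_ (dots-substᵗ e I ω) (dots-substᵗ d I ω))
    (subst₂ _≤_ (sym (dots-substᵗ e I ω)) (sym (dots-substᵗ d I ω)))
    where
    J = I [·↦ ⟦ θs ⟧ᵗˢ I ω ]
  dots-substᶠ (keep {p = p} _ d) I ω = cong (predᴵ I p) (dots-substᵗˢ d I ω)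
  dots-substᶠ (neg d)     I ω = cong not (dots-substᶠ d I ω)
  dots-substᶠ (d ⩓ e)     I ω = cong₂ _∧_ (dots-substᶠ d I ω) (dots-substᶠ e I ω)
  dots-substᶠ {θs = θs} (ex {x} {φ} {φ′} adm d) I ω = ⟪⟫-≡
    (λ ω → ∃[ r ] ω [ x ↦ r ] ∈ᵖ ⟦ φ′ ⟧ᶠ I) (λ ω′ → ∃[ r ] ω′ [ x ↦ r ] ∈ᵖ ⟦ φ ⟧ᶠ (I [·↦ ⟦ θs ⟧ᵗˢ I ω ]))
    (λ (r , p) → r , subst T (near r) p) (λ (r , p) → r , subst T (sym (near r)) p)
    where
    near = λ r → dots-subst-nearᶠ adm d I (ω [ x ↦ r ]) (λ y x≢y → update-other ω (x≢y ∘ sym))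
  -- By the bound effect only states that differ from `ω` within `BV α′` matter, and there
  -- admissibility lets the dots stay frozen at `ω`.
  dots-substᶠ (dia {α′ = α′} d adm e) I ω = trans
    (⟦ α′ ⟧ᵍ-local-≡ λ ν ω≈ν → dots-subst-nearᶠ adm e I ν (λ x x∉ → sym (ω≈ν x x∉)))
    (dots-substᵍ d I ω _)

  dots-substᵍ (keep _) I ω X = refl
  dots-substᵍ (asgn {x} d) I ω X = cong (λ r → X (ω [ x ↦ r ])) (dots-substᵗ d I ω)
  dots-substᵍ {θs = θs} (ode {x} {θ} {θ′} {ψ} {ψ′} admθ admψ d e) I ω X = ⟪⟫-≡
    (Evolution x (⟦ θ′ ⟧ᵗ I) (⟦ ψ′ ⟧ᶠ I) X) (Evolution x (⟦ θ ⟧ᵗ J) (⟦ ψ ⟧ᶠ J) X)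
    (Evolution-cong nearᵗ nearᶠ)
    (Evolution-cong (λ s s≈ω → sym (nearᵗ s s≈ω)) (λ s s≈ω → sym (nearᶠ s s≈ω)))
    where
    J = I [·↦ ⟦ θs ⟧ᵗˢ I ω ]

    nearᵗ : ∀ s → Agree (∁ (｛ x ｝ ∪ ｛ x ′ ｝)) s ω → ⟦ θ′ ⟧ᵗ I s ≡ ⟦ θ ⟧ᵗ J s
    nearᵗ s s≈ω = trans (dots-substᵗ d I s)
      (coincidenceᵗ θ (Coincide.funs (admissible⇒coincide θs {I = I} admθ s≈ω)) (λ _ _ → refl))

    nearᶠ : ∀ s → Agree (∁ (｛ x ｝ ∪ ｛ x ′ ｝)) s ω → ⟦ ψ′ ⟧ᶠ I s ≡ ⟦ ψ ⟧ᶠ J s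
    nearᶠ s s≈ω = dots-subst-nearᶠ admψ e I s s≈ω
  dots-substᵍ (test d) I ω X = cong (_∧ X ω) (dots-substᶠ d I ω)
  dots-substᵍ (d ⊔ e)  I ω X = cong₂ _∨_ (dots-substᵍ d I ω X) (dots-substᵍ e I ω X)
  dots-substᵍ (seq {α′ = α′} d adm e) I ω X = trans
    (⟦ α′ ⟧ᵍ-local-≡ λ ν ω≈ν → dots-subst-nearᵍ adm e I ν (λ x x∉ → sym (ω≈ν x x∉)) X)
    (dots-substᵍ d I ω _)
  dots-substᵍ {θs = θs} (loop {α} {α′} d adm) I ω X = ⟪⟫-≡ (Loop F X) (Loop G X)
    (Loop-local (∁ (BV α′)) near local)
    -- `BV α′` speaks of `F`; that `G` is confined in the same way is carried over along `near`.
    (Loop-local (∁ (BV α′)) (λ ν ω≈ν Z → sym (near ν ω≈ν Z))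
      λ {ν} {Y} {Z} ω≈ν Y⊆Z → subst T (near ν ω≈ν Z) ∘ local ω≈ν Y⊆Z ∘ subst T (sym (near ν ω≈ν Y)))
    where
    F = ⟦ α′ ⟧ᵍ I
    G = ⟦ α ⟧ᵍ (I [·↦ ⟦ θs ⟧ᵗˢ I ω ])

    near : ∀ ν → Agree (∁ (BV α′)) ω ν → ∀ Z → F Z ν ≡ G Z ν
    near ν ω≈ν Z = dots-subst-nearᵍ adm d I ν (λ x x∉ → sym (ω≈ν x x∉)) Z

    local : ∀ {ν Y Z} → Agree (∁ (BV α′)) ω ν → (∀ {μ} → Agree (∁ (BV α′)) ω μ → μ ∈ᵖ Y → μ ∈ᵖ Z) →
            ν ∈ᵖ F Y → ν ∈ᵖ F Z
    local {Y = Y} {Z} ω≈ν Y⊆Z = ⟦ α′ ⟧ᵍ-local {X = Y} {Z} λ ν≈μ → Y⊆Z λ x x∉ → trans (ω≈ν x x∉) (ν≈μ x x∉)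
  dots-substᵍ (dual d) I ω X = cong not (dots-substᵍ d I ω (∁ᵖ X))

  Smooth-!? : ∀ {k} c i → Smooth {k} (λ d → fromMaybe c (d !? i))
  Smooth-!? {zero}  c i       = subst Smooth (ext λ { [] → refl }) (Smooth-const c)
  Smooth-!? {suc k} c zero    = subst Smooth (ext λ { (_ ∷ _) → refl }) (Smooth-lookup Fin.zero)
  Smooth-!? {suc k} c (suc i) = subst Smooth (ext λ { (_ ∷ _) → refl }) (Smooth-tail (Smooth-!? c i))

  -- The adjoint interpretation.

  module Adjoint (σ : Subst) (FV≡∅ : Empty (FVˢ σ)) (I : Interpretation) where

    -- By FV(σ) = ∅, the replacements may be evaluated in any state.
    ω₀ : State
    ω₀ _ = 0#

    -- Only functions and predicates are evaluated at a fixed state. A game symbol denotes an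
    -- operator on sets of states, so its replacement keeps its dependence on the state.
    adjoint : Interpretation
    adjoint = record
      { funᴵ   = λ f → maybe′ (λ θ d → ⟦ θ ⟧ᵗ (I [·↦ d ]) ω₀) (funᴵ I f) (fun⁺ σ f)
      ; smooth = smooth-adjoint
      ; predᴵ  = λ p → maybe′ (λ φ d → ⟦ φ ⟧ᶠ (I [·↦ d ]) ω₀) (predᴵ I p) (pred⁺ σ p)
      ; gameᴵ  = λ a → maybe′ (λ α → ⟦ α ⟧ᵍ I) (gameᴵ I a) (game⁺ σ a)
      ; mono   = mono-adjoint
      }
      where
      smooth-adjoint : ∀ {k} (f : FunSym k) →
                       Smooth (maybe′ (λ θ d → ⟦ θ ⟧ᵗ (I [·↦ d ]) ω₀) (funᴵ I f) (fun⁺ σ f))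
      smooth-adjoint f with fun⁺ σ f
      -- The parameters are the arguments themselves: each dot is a coordinate or a constant, and
      -- the state is constant.
      ... | just θ  = Smooth-⟦⟧ᵗ θ {I} (λ i → Smooth-!? _ i) (λ _ → Smooth-const 0#)
      ... | nothing = smooth I f

      mono-adjoint : ∀ a {X Y} → X ⊆ᵖ Y → maybe′ (λ α → ⟦ α ⟧ᵍ I) (gameᴵ I a) (game⁺ σ a) X ⊆ᵖ
                                          maybe′ (λ α → ⟦ α ⟧ᵍ I) (gameᴵ I a) (game⁺ σ a) Y
      mono-adjoint a X⊆Y with game⁺ σ a
      ... | just α  = ⟦ α ⟧ᵍ-mono X⊆Y
      ... | nothing = mono I a X⊆Y

    substᵗ  : ∀ {θ θ′} → σ ⊢ θ ↦ᵗ θ′ → ∀ ω → ⟦ θ′ ⟧ᵗ I ω ≡ ⟦ θ ⟧ᵗ adjoint ω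
    substᵗˢ : ∀ {k} {θs θs′ : Vec Term k} → σ ⊢ θs ↦ᵗˢ θs′ → ∀ ω → ⟦ θs′ ⟧ᵗˢ I ω ≡ ⟦ θs ⟧ᵗˢ adjoint ω

    substᵗ var ω = refl
    substᵗ (keep {f = f} {θs} eq d) ω = trans (cong (funᴵ I f) (substᵗˢ d ω))
      (cong (λ m → maybe′ (λ θ d → ⟦ θ ⟧ᵗ (I [·↦ d ]) ω₀) (funᴵ I f) m (⟦ θs ⟧ᵗˢ adjoint ω)) (sym eq))
    substᵗ (repl {f = f} {θs} {θs′} {σf} {η} eq d e) ω = begin
      ⟦ η ⟧ᵗ I ω
        ≡⟨ dots-substᵗ e I ω ⟩
      ⟦ σf ⟧ᵗ (I [·↦ ⟦ θs′ ⟧ᵗˢ I ω ]) ω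
        ≡⟨ FVᵗ-coincidence σf (λ x x∈FV → contradiction (inj₁ (_ , f , σf , eq , x∈FV)) (FV≡∅ x)) ⟩
      ⟦ σf ⟧ᵗ (I [·↦ ⟦ θs′ ⟧ᵗˢ I ω ]) ω₀
        ≡⟨ cong (λ d → ⟦ σf ⟧ᵗ (I [·↦ d ]) ω₀) (substᵗˢ d ω) ⟩
      ⟦ σf ⟧ᵗ (I [·↦ ⟦ θs ⟧ᵗˢ adjoint ω ]) ω₀
        ≡⟨ cong (λ m → maybe′ (λ θ d → ⟦ θ ⟧ᵗ (I [·↦ d ]) ω₀) (funᴵ I f) m (⟦ θs ⟧ᵗˢ adjoint ω)) (sym eq) ⟩
      funᴵ adjoint f (⟦ θs ⟧ᵗˢ adjoint ω) ∎
      where open ≡-Reasoning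
    substᵗ (d ⊕ e) ω = cong₂ _+_ (substᵗ d ω) (substᵗ e ω)
    substᵗ (d ⊙ e) ω = cong₂ _*_ (substᵗ d ω) (substᵗ e ω)
    substᵗ (D _ d) ω = cong (λ F → ∑𝒱 λ x → ω (x ′) * ∂ F x ω) (ext (substᵗ d))

    substᵗˢ []      ω = refl
    substᵗˢ (d ∷ e) ω = cong₂ _∷_ (substᵗ d ω) (substᵗˢ e ω)

    -- One interpretation serves all states, so whole sets are equal, not only their values at one
    -- state, and the cases for binders are congruences.
    substᶠ : ∀ {φ φ′} → σ ⊢ φ ↦ᶠ φ′ → ⟦ φ′ ⟧ᶠ I ≡ ⟦ φ ⟧ᶠ adjoint
    substᵍ : ∀ {α α′} → σ ⊢ α ↦ᵍ α′ → ⟦ α′ ⟧ᵍ I ≡ ⟦ α ⟧ᵍ adjoint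

    substᶠ (d ⩾ e) = cong₂ (λ f g → ⟪ (λ ω → g ω ≤ f ω) ⟫) (ext (substᵗ d)) (ext (substᵗ e))
    substᶠ (keep {p = p} eq d) = cong₂ (λ P f ω → P (f ω))
      (cong (maybe′ (λ φ d → ⟦ φ ⟧ᶠ (I [·↦ d ]) ω₀) (predᴵ I p)) (sym eq)) (ext (substᵗˢ d))
    substᶠ (repl {p = p} {θs} {θs′} {σp} {χ} eq d e) = ext λ ω → begin
      ⟦ χ ⟧ᶠ I ω
        ≡⟨ dots-substᶠ e I ω ⟩
      ⟦ σp ⟧ᶠ (I [·↦ ⟦ θs′ ⟧ᵗˢ I ω ]) ω
        ≡⟨ FVᶠ-empty σp (λ x x∈FV → FV≡∅ x (inj₂ (_ , p , σp , eq , x∈FV))) _ ω ω₀ ⟩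
      ⟦ σp ⟧ᶠ (I [·↦ ⟦ θs′ ⟧ᵗˢ I ω ]) ω₀
        ≡⟨ cong (λ d → ⟦ σp ⟧ᶠ (I [·↦ d ]) ω₀) (substᵗˢ d ω) ⟩
      ⟦ σp ⟧ᶠ (I [·↦ ⟦ θs ⟧ᵗˢ adjoint ω ]) ω₀
        ≡⟨ cong (λ m → maybe′ (λ φ d → ⟦ φ ⟧ᶠ (I [·↦ d ]) ω₀) (predᴵ I p) m (⟦ θs ⟧ᵗˢ adjoint ω)) (sym eq) ⟩
      predᴵ adjoint p (⟦ θs ⟧ᵗˢ adjoint ω) ∎
      where open ≡-Reasoning
    substᶠ (neg d)         = cong ∁ᵖ (substᶠ d)
    substᶠ (d ⩓ e)         = cong₂ _∩ᵖ_ (substᶠ d) (substᶠ e)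
    substᶠ (ex {x} _ d)    = cong (λ X → ⟪ (λ ω → ∃[ r ] ω [ x ↦ r ] ∈ᵖ X) ⟫) (substᶠ d)
    substᶠ (dia d _ e)     = cong₂ (λ F X → F X) (substᵍ d) (substᶠ e)

    substᵍ (keep {a} eq)       = cong (maybe′ (λ α → ⟦ α ⟧ᵍ I) (gameᴵ I a)) (sym eq)
    substᵍ (repl {a} eq)       = cong (maybe′ (λ α → ⟦ α ⟧ᵍ I) (gameᴵ I a)) (sym eq)
    substᵍ (asgn {x} d)        = cong (λ (f : State → ℝ) X ω → X (ω [ x ↦ f ω ])) (ext (substᵗ d))
    substᵍ (ode {x} _ _ d e)   = cong₂ (λ F Q X → ⟪ Evolution x F Q X ⟫) (ext (substᵗ d)) (substᶠ e)
    substᵍ (test d)            = cong _∩ᵖ_ (substᶠ d)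
    substᵍ (d ⊔ e)             = cong₂ (λ F G X → F X ∪ᵖ G X) (substᵍ d) (substᵍ e)
    substᵍ (seq d _ e)         = cong₂ (λ F G X → F (G X)) (substᵍ d) (substᵍ e)
    substᵍ (loop d _)          = cong (λ F X → ⟪ Loop F X ⟫) (substᵍ d)
    substᵍ (dual d)            = cong (λ F X → ∁ᵖ (F (∁ᵖ X))) (substᵍ d)

-- Transfer of local soundness.

theorem11 : (ℛ : Reals) (em : ExcludedMiddle 0ℓ) (ext : Extensionality 0ℓ 0ℓ) (ℒ : Language) →
    let open dGL ℛ em ℒ in
    (n : ℕ) (φ : Fin n → Formula) (ψ : Formula) (σ : Subst) →
    (σφ : ∀ i → Admissible σ (φ i)) (σψ : Admissible σ ψ) →
    Empty (FVˢ σ) →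
    LocallySound φ ψ →
    LocallySound (λ i → apply (σφ i)) (apply σψ)
theorem11 ℛ em ext ℒ n φ ψ σ σφ σψ FV≡∅ sound I valid ω =
  subst (λ X → T (X ω)) (sym (substᶠ (proj₂ σψ)))
    (sound adjoint (λ i ν → subst (λ X → T (X ν)) (substᶠ (proj₂ (σφ i))) (valid i ν)) ω)
  where
  open Substitution ℛ em ext ℒ
  open Adjoint σ FV≡∅ I
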